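{- If for some $\delta>0$ there is a $(5/3-\delta)$-approximation algorithm for the eccentricities of all nodes in undirected sparse graphs that runs in subquadratic time, then the Orthogonal Vectors Conjecture is false.
   Context: In an undirected graph $G=(V,E)$ the eccentricity of a node $v$ is $\max_{u\in V} d(v,u)$, where $d$ is the shortest path distance. A $c$-approximation algorithm for all eccentricities outputs, for every node $v$, an estimate of its eccentricity that is within a multiplicative factor $c$ (up to rescaling: if $\mathrm{ecc}(v)$ is the eccentricity, the estimate lies in $[\mathrm{ecc}(v),c\cdot \mathrm{ecc}(v)]$, equivalently after dividing by $c$ in $[\mathrm{ecc}(v)/c,\mathrm{ecc}(v)]$). A sparse graph is a graph with $n$ nodes and $O(n)$ edges. Subquadratic time means time $O(n^{2-\varepsilon})$ for some $\varepsilon>0$. Running times are in the standard word-RAM model with $O(\log n)$-bit words. Orthogonal Vectors (OV) Conjecture: there is no $\varepsilon>0$ such that for all $c\ge 1$ there is an algorithm that, given two lists $A,B\subseteq\{0,1\}^d$ of $n$ boolean vectors with $d=c\log n$, determines in $O(n^{2-\varepsilon})$ time whether there is an orthogonal pair $a\in A$, $b\in B$. -}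

module Defs where

open import Data.Bool.Base using (Bool; true; false; _∧_; _∨_; _xor_; if_then_else_)
open import Data.Fin.Base as Fin using (Fin; toℕ)
open import Data.Integer.Base using (+_; ∣_∣)
open import Data.List.Base as List using (List; []; _∷_; _++_; head; drop; length; concatMap)
open import Data.List.Membership.Propositional using (_∈_)
open import Data.List.Relation.Unary.All using (All)
open import Data.List.Relation.Unary.Unique.Propositional using (Unique)
open import Data.Maybe.Base using (Maybe; just; fromMaybe)
open import Data.Nat.Base
open import Data.Nat.Logarithm using (⌊log₂_⌋)
open import Data.Nat.Properties using (m^n≢0)
open import Data.Product.Base using (_×_; _,_; ∃-syntax; proj₁; proj₂; uncurry)
open import Data.Rational.Base as ℚ using (ℚ; 0ℚ; 1ℚ; ↥_; ↧ₙ_)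
open import Data.Sum.Base using (_⊎_)
open import Data.Vec.Base as Vec using (Vec; lookup; zipWith; toList)
open import Relation.Binary.PropositionalEquality.Core using (_≡_; _≢_)
open import Relation.Nullary.Negation.Core using (¬_)

------------------------------------------------------------------------
-- Word RAM
--
-- Unit-cost machine on w-bit words, with registers and a word-addressed
-- memory.  A step that would produce a value outside [0, 2^w) has no
-- successor, so a halting run certifies that every word it computes, and
-- hence every address it uses, fits in w bits.  Compared with arithmetic
-- modulo 2^w this changes w and the running time by constant factors only.

toBit : Bool → ℕ
toBit b = if b then 1 else 0

-- Acts on the `fuel` lowest binary digits; m ⊔ n digits always suffice
-- because m < 2^m.
bitwise : (Bool → Bool → Bool) → (fuel m n : ℕ) → ℕ
bitwise f zero       m n = 0
bitwise f (suc fuel) m n =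
  toBit (f (m % 2 ≡ᵇ 1) (n % 2 ≡ᵇ 1)) + 2 * bitwise f fuel (m / 2) (n / 2)

data BinOp : Set where
  add sub mul quot rem and or xor shl shr : BinOp

-- Subtraction truncates at 0; x quot 0 = 0 and x rem 0 = x.
⟦_⟧ : BinOp → ℕ → ℕ → ℕ
⟦ add  ⟧ x y         = x + y
⟦ sub  ⟧ x y         = x ∸ y
⟦ mul  ⟧ x y         = x * y
⟦ quot ⟧ x zero      = 0
⟦ quot ⟧ x y@(suc _) = x / y
⟦ rem  ⟧ x zero      = x
⟦ rem  ⟧ x y@(suc _) = x % y
⟦ and  ⟧ x y         = bitwise _∧_ (x ⊔ y) x y
⟦ or   ⟧ x y         = bitwise _∨_ (x ⊔ y) x y
⟦ xor  ⟧ x y         = bitwise _xor_ (x ⊔ y) x y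
⟦ shl  ⟧ x y         = x * 2 ^ y
⟦ shr  ⟧ x y         = _/_ x (2 ^ y) {{m^n≢0 2 y}}

Reg Addr Label : Set
Reg   = ℕ
Addr  = ℕ
Label = ℕ

data Instr : Set where
  const : (r : Reg) (v : ℕ) → Instr
  op    : (⊕ : BinOp) (r x y : Reg) → Instr
  load  : (r a : Reg) → Instr
  store : (a r : Reg) → Instr
  jump  : (l : Label) → Instr
  jumpz : (r : Reg) (l : Label) → Instr
  halt  : Instr

Program : Set
Program = List Instr

infix 9 _‼_
_‼_ : {A : Set} → List A → ℕ → Maybe A
xs ‼ i = head (drop i xs)

infix 9 _[_≔_]
_[_≔_] : (ℕ → ℕ) → ℕ → ℕ → (ℕ → ℕ)
(f [ i ≔ v ]) j = if j ≡ᵇ i then v else f j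

record Config : Set where
  constructor ⟨_,_,_⟩
  field
    pc  : Label
    reg : Reg → ℕ
    mem : Addr → ℕ

open Config public

module Machine (w : ℕ) (P : Program) where

  data _⟶_ : Config → Config → Set where

    const : ∀ {i ρ μ r v} → P ‼ i ≡ just (const r v) →
            v < 2 ^ w →
            ⟨ i , ρ , μ ⟩ ⟶ ⟨ suc i , ρ [ r ≔ v ] , μ ⟩

    op    : ∀ {i ρ μ ⊕ r x y} → P ‼ i ≡ just (op ⊕ r x y) →
            ⟦ ⊕ ⟧ (ρ x) (ρ y) < 2 ^ w →
            ⟨ i , ρ , μ ⟩ ⟶ ⟨ suc i , ρ [ r ≔ ⟦ ⊕ ⟧ (ρ x) (ρ y) ] , μ ⟩

    load  : ∀ {i ρ μ r a} → P ‼ i ≡ just (load r a) →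
            μ (ρ a) < 2 ^ w →
            ⟨ i , ρ , μ ⟩ ⟶ ⟨ suc i , ρ [ r ≔ μ (ρ a) ] , μ ⟩

    store : ∀ {i ρ μ a r} → P ‼ i ≡ just (store a r) →
            ⟨ i , ρ , μ ⟩ ⟶ ⟨ suc i , ρ , μ [ ρ a ≔ ρ r ] ⟩

    jump  : ∀ {i ρ μ l} → P ‼ i ≡ just (jump l) →
            ⟨ i , ρ , μ ⟩ ⟶ ⟨ l , ρ , μ ⟩

    jumpz-taken : ∀ {i ρ μ r l} → P ‼ i ≡ just (jumpz r l) →
                  ρ r ≡ 0 →
                  ⟨ i , ρ , μ ⟩ ⟶ ⟨ l , ρ , μ ⟩

    jumpz-skipped : ∀ {i ρ μ r l} → P ‼ i ≡ just (jumpz r l) →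
                    ρ r ≢ 0 →
                    ⟨ i , ρ , μ ⟩ ⟶ ⟨ suc i , ρ , μ ⟩

  data _⟶[_]_ : Config → ℕ → Config → Set where
    done : ∀ {s} → s ⟶[ 0 ] s
    step : ∀ {s s′ s″ t} → s ⟶ s′ → s′ ⟶[ t ] s″ → s ⟶[ suc t ] s″

  Halted : Config → Set
  Halted s = P ‼ pc s ≡ just halt

-- Registers and all memory beyond the input start at 0.
Initial : List ℕ → Config → Set
Initial input s =
  pc s ≡ 0 × (∀ r → reg s r ≡ 0) × (∀ a → mem s a ≡ fromMaybe 0 (input ‼ a))

-- Started on the input with w-bit words, P halts after some number t of
-- steps with T t, leaving a memory that satisfies Q.
Computes : (w : ℕ) → Program → List ℕ → (T : ℕ → Set) → (Q : (Addr → ℕ) → Set) → Set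
Computes w P input T Q =
  ∀ s → Initial input s →
  ∃[ t ] ∃[ s′ ] (s ⟶[ t ] s′) × Halted s′ × T t × Q (mem s′)
  where open Machine w P

-- k times the number of bits of n.
wordLength : (k n : ℕ) → ℕ
wordLength k n = k * (1 + ⌊log₂ n ⌋)

-- For ε = p/q > 0 this is t ≤ C · n^(2 − p/q), raised to the power q and
-- multiplied by n^p.
Within_·_^2-_ : (C n : ℕ) (ε : ℚ) → ℕ → Set
(Within C · n ^2- ε) t = t ^ q * n ^ p ≤ (C * n ^ 2) ^ q
  where
  p = ∣ ↥ ε ∣
  q = ↧ₙ ε

------------------------------------------------------------------------
-- Graphs and eccentricities

-- Finite simple undirected graphs: the edge {u , v} with u < v is listed
-- once, as (u , v).
record Graph : Set where
  field
    order   : ℕ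
    edges   : List (Fin order × Fin order)
    ordered : All (uncurry Fin._<_) edges
    unique  : Unique edges

  Vertex : Set
  Vertex = Fin order

  size : ℕ
  size = length edges

  Adjacent : Vertex → Vertex → Set
  Adjacent u v = (u , v) ∈ edges ⊎ (v , u) ∈ edges

  data Walk : Vertex → Vertex → ℕ → Set where
    []  : ∀ {u} → Walk u u 0
    _∷_ : ∀ {u v x k} → Adjacent u v → Walk v x k → Walk u x (suc k)

  Connected : Set
  Connected = ∀ u v → ∃[ k ] Walk u v k

  IsDistance : Vertex → Vertex → ℕ → Set
  IsDistance u v k = Walk u v k × (∀ j → Walk u v j → k ≤ j)

  IsEccentricity : Vertex → ℕ → Set
  IsEccentricity v e =
    (∃[ u ] IsDistance v u e) × (∀ u k → IsDistance v u k → k ≤ e)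

open Graph public using (order; size; edges; Vertex; Connected; IsEccentricity)

ℕ⇒ℚ : ℕ → ℚ
ℕ⇒ℚ n = + n ℚ./ 1

encodeGraph : Graph → List ℕ
encodeGraph G =
  order G ∷ size G ∷ concatMap (λ (u , v) → toℕ u ∷ toℕ v ∷ []) (edges G)

-- Cell v of the final memory holds the estimate for vertex v.  Integer
-- estimates lose nothing: eccentricities are integers, so rounding an
-- estimate down keeps it in [ecc v , c · ecc v].
ApproximatesEccentricities : ℚ → Graph → (Addr → ℕ) → Set
ApproximatesEccentricities c G μ =
  ∀ (v : Vertex G) e → IsEccentricity G v e →
  e ≤ μ (toℕ v) × ℕ⇒ℚ (μ (toℕ v)) ℚ.≤ c ℚ.* ℕ⇒ℚ e

-- "Sparse" means at most K · n edges; there may be a different algorithm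
-- and exponent for each constant K.  Inputs are connected, so that all
-- eccentricities are finite.
SubquadraticSparseEccentricities : ℚ → Set
SubquadraticSparseEccentricities c =
  ∀ (K : ℕ) →
  ∃[ ε ] 0ℚ ℚ.< ε ×
  ∃[ P ] ∃[ k ] ∃[ C ]
    ((G : Graph) → Connected G → size G ≤ K * order G →
     Computes (wordLength k (order G)) P (encodeGraph G)
       (Within C · order G ^2- ε)
       (ApproximatesEccentricities c G))

------------------------------------------------------------------------
-- Orthogonal vectors

inner : ∀ {d} → Vec Bool d → Vec Bool d → ℕ
inner a b = Vec.sum (zipWith (λ x y → toBit x * toBit y) a b)

HasOrthogonalPair : ∀ {n d} → Vec (Vec Bool d) n → Vec (Vec Bool d) n → Set
HasOrthogonalPair A B = ∃[ i ] ∃[ j ] inner (lookup A i) (lookup B j) ≡ 0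

encodeVectors : ∀ {n d} → Vec (Vec Bool d) n → List ℕ
encodeVectors A = concatMap (λ a → List.map toBit (toList a)) (toList A)

encodeOV : ∀ {n d} → Vec (Vec Bool d) n → Vec (Vec Bool d) n → List ℕ
encodeOV {n} {d} A B = n ∷ d ∷ encodeVectors A ++ encodeVectors B

DecidesOV : ∀ {n d} → Vec (Vec Bool d) n → Vec (Vec Bool d) n → (Addr → ℕ) → Set
DecidesOV A B μ =
  (HasOrthogonalPair A B × μ 0 ≡ 1) ⊎ (¬ HasOrthogonalPair A B × μ 0 ≡ 0)

-- For c = p/q > 0 this equals ⌊c · log₂ n⌋ for n ≥ 1, as
-- ⌊⌊q · x⌋ / q⌋ = ⌊x⌋.
⌊_·log₂_⌋ : ℚ → ℕ → ℕ
⌊ c ·log₂ n ⌋ = ⌊log₂ (n ^ ∣ ↥ c ∣) ⌋ / ↧ₙ c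

SubquadraticOV : (ε c : ℚ) → Set
SubquadraticOV ε c =
  ∃[ P ] ∃[ k ] ∃[ C ]
    (∀ n (A B : Vec (Vec Bool ⌊ c ·log₂ n ⌋) n) →
     Computes (wordLength k n) P (encodeOV A B)
       (Within C · n ^2- ε)
       (DecidesOV A B))

OVConjecture : Set
OVConjecture =
  ¬ (∃[ ε ] 0ℚ ℚ.< ε × (∀ c → 1ℚ ℚ.≤ c → SubquadraticOV ε c))

{-# OPTIONS --safe #-}
module Submission where

-- Given vectors A and B, join every a ∈ A to a vertex "apex", join the apex to
-- a vertex "hub", join the hub to all coordinates and to one extra coordinate 0,
-- and join every b ∈ B to coordinate 0.  A vector is joined to the coordinates
-- at which it is 1, and carries a pendant vertex.  Then a has eccentricity 3,
-- unless it is orthogonal to some b, whose pendant is then at distance 5; a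
-- (5/3 − δ)-approximation separates the two cases.
-- To keep the graph sparse, every bit also owns a leaf at the apex; a bit 0
-- spends its second edge on joining the leaf to the hub, which makes the
-- numbers of vertices and edges functions of n and d alone.
--
-- The graph has N = O(n log n) vertices, so a running time O(N^(2 − 1/q))
-- becomes O(n^(2 − 1/2q)), with an exponent independent of the dimension
-- constant.  On the word RAM, the reduction writes the graph behind its input
-- and runs the given program relocated to that place.

-- If a and b share a 1, the route from a through that coordinate to b and its pendant has length 3.
-- If they do not, no route is shorter than a, apex, hub, coordinate 0, b, pendant. This lower bound
-- concerns all walks; it comes from a function on the vertices that changes by at most 1 along each
-- edge, so that no walk has to be analysed. The estimate for a is then at least 5, whereas
-- eccentricity 3 allows at most (5/3 - δ) · 3 < 5; integers are separated by the threshold 4. The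
-- exponent of the given algorithm may depend on the sparsity constant, but one ε has to serve every
-- dimension constant. Hence the ratio of edges to vertices must stay below one fixed constant, here
-- 2. The logarithmic factor in the number of vertices is paid for with half of the saving in the
-- exponent. A machine step that overflows has no successor, so correctness of code includes a bound
-- on every word. The guest also expects blank registers and blank memory behind its input;
-- registers from 16 on and the untouched cells behind the graph provide them.

open import Defs
open import Data.Bool.Base using (Bool; true; false; if_then_else_; T; _∧_; not)
open import Data.Bool.Properties using (T-∧)
open import Data.Fin.Base using (Fin; zero; suc; toℕ; combine; remQuot; splitAt; join; _↑ʳ_)
open import Data.Fin.Properties as Finₚ using (splitAt-join; join-splitAt; remQuot-combine; combine-remQuot; toℕ-↑ˡ; toℕ-↑ʳ; toℕ-combine; toℕ<n)
open import Data.Integer.Base as ℤ using (∣_∣; +[1+_]; -[1+_])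
import Data.Integer.Properties as ℤₚ
open import Data.List.Base as List using (List; []; _∷_; _++_; length; drop; concat; tabulate; map; concatMap)
open import Data.List.Properties using (length-++; ++-assoc; ++-identityʳ; concatMap-++; concatMap-map; length-map; length-tabulate)
open import Data.List.Membership.Propositional using (_∈_)
open import Data.List.Membership.Propositional.Properties using (∈-map⁺; ∈-map⁻; ∈-++⁺ˡ; ∈-++⁺ʳ; ∈-concat⁺′; ∈-tabulate⁺)
open import Data.List.Relation.Unary.All as All using (All; []; _∷_)
import Data.List.Relation.Unary.All.Properties as Allₚ
open import Data.List.Relation.Unary.AllPairs using ([]; _∷_)
import Data.List.Relation.Unary.AllPairs.Properties as AllPairsₚ
open import Data.List.Relation.Unary.Any using (here; there)
open import Data.List.Relation.Unary.Unique.Propositional using (Unique)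
import Data.List.Relation.Unary.Unique.Propositional.Properties as Uniqueₚ
open import Data.Maybe.Base using (Maybe; just; nothing; fromMaybe)
open import Data.Maybe.Properties using (just-injective)
open import Data.Nat.Base
open import Data.Nat.Coprimality using (1-coprimeTo)
open import Data.Nat.DivMod using (n/1≡n; m*n/n≡m; m/n≤m; m≡m%n+[m/n]*n; m%n<n; m/n*n≤m)
open import Data.Nat.Induction using (<-rec)
open import Data.Nat.Logarithm using (⌊log₂_⌋; ⌊log₂⌋-mono-≤; ⌊log₂⌊n/2⌋⌋≡⌊log₂n⌋∸1; ⌊log₂[2^n]⌋≡n)
open import Data.Nat.Properties
open import Data.Nat.Solver using (module +-*-Solver)
open import Data.Product.Base using (_×_; _,_; ∃-syntax; proj₁; proj₂; uncurry)
open import Data.Product.Properties using (,-injective)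
open import Data.Rational.Base as ℚ using (ℚ; mkℚ; 0ℚ; 1ℚ; ↥_; ↧ₙ_)
import Data.Rational.Properties as ℚₚ
import Data.Rational.Unnormalised.Base as ℚᵘ
import Data.Rational.Unnormalised.Properties as ℚᵘₚ
open import Data.Sum.Base using (_⊎_; inj₁; inj₂)
open import Data.Unit.Base using (tt)
open import Data.Vec.Base using (Vec; []; _∷_; toList; lookup)
open import Function.Base using (_∘_)
open import Function.Bundles using (module Equivalence)
open import Relation.Binary.PropositionalEquality
open import Relation.Nullary.Decidable.Core using (yes; no; does)
open import Relation.Nullary.Negation.Core using (¬_; contradiction)

-- The graph of an orthogonal vectors instance

⋃ : ∀ {A : Set} {m} → (Fin m → List A) → List A
⋃ f = concat (tabulate f)

⋃-All : ∀ {A : Set} {P : A → Set} {m} {f : Fin m → List A} → (∀ i → All P (f i)) → All P (⋃ f)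
⋃-All p = Allₚ.concat⁺ (Allₚ.tabulate⁺ p)

⋃-∈ : ∀ {A : Set} {m} {f : Fin m → List A} {a} i → a ∈ f i → a ∈ ⋃ f
⋃-∈ {f = f} i a∈fi = ∈-concat⁺′ a∈fi (∈-tabulate⁺ i)

-- A key that is constant on each part and separates the parts makes them disjoint.
⋃-unique : ∀ {A : Set} {m} {f : Fin m → List A} (key : A → Maybe (Fin m)) →
           (∀ i → Unique (f i)) → (∀ i → All (λ a → key a ≡ just i) (f i)) → Unique (⋃ f)
⋃-unique key f! keyed = Uniqueₚ.concat⁺ (Allₚ.tabulate⁺ f!)
  (AllPairsₚ.tabulate⁺ λ {i} {j} i≢j (a∈fi , a∈fj) →
    i≢j (just-injective (trans (sym (All.lookup (keyed i) a∈fi)) (All.lookup (keyed j) a∈fj))))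

-- Vertices and their numbers

data Node (n d : ℕ) : Set where
  apex hub : Node n d
  coord    : Fin (suc d) → Node n d
  vec pend : Fin 2 → Fin n → Node n d
  leaf     : Fin 2 → Fin n → Fin d → Node n d

module Numbering (n d : ℕ) where

  nodes : ℕ
  nodes = (3 + d) + 2 * (n * (2 + d))

  slot : Fin 2 → Fin n → Fin (2 + d) → Fin (2 * (n * (2 + d)))
  slot s i k = combine s (combine i k)

  toSum : Node n d → Fin (3 + d) ⊎ Fin (2 * (n * (2 + d)))
  toSum apex         = inj₁ zero
  toSum hub          = inj₁ (suc zero)
  toSum (coord j)    = inj₁ (suc (suc j))
  toSum (vec s i)    = inj₂ (slot s i zero)
  toSum (pend s i)   = inj₂ (slot s i (suc zero))
  toSum (leaf s i j) = inj₂ (slot s i (suc (suc j)))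

  atSlot : Fin 2 → Fin n → Fin (2 + d) → Node n d
  atSlot s i zero          = vec s i
  atSlot s i (suc zero)    = pend s i
  atSlot s i (suc (suc j)) = leaf s i j

  fromBlock : Fin 2 × Fin (n * (2 + d)) → Node n d
  fromBlock (s , r) = uncurry (atSlot s) (remQuot (2 + d) r)

  fromSlot : Fin (2 * (n * (2 + d))) → Node n d
  fromSlot r = fromBlock (remQuot (n * (2 + d)) r)

  fromSum : Fin (3 + d) ⊎ Fin (2 * (n * (2 + d))) → Node n d
  fromSum (inj₁ zero)          = apex
  fromSum (inj₁ (suc zero))    = hub
  fromSum (inj₁ (suc (suc j))) = coord j
  fromSum (inj₂ r)             = fromSlot r

  fromSlot-slot : ∀ s i k → fromSlot (slot s i k) ≡ atSlot s i k
  fromSlot-slot s i k = trans (cong fromBlock (remQuot-combine s (combine i k)))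
    (cong (uncurry (atSlot s)) (remQuot-combine i k))

  fromSum-toSum : ∀ u → fromSum (toSum u) ≡ u
  fromSum-toSum apex         = refl
  fromSum-toSum hub          = refl
  fromSum-toSum (coord j)    = refl
  fromSum-toSum (vec s i)    = fromSlot-slot s i zero
  fromSum-toSum (pend s i)   = fromSlot-slot s i (suc zero)
  fromSum-toSum (leaf s i j) = fromSlot-slot s i (suc (suc j))

  toSum-atSlot : ∀ s i k → toSum (atSlot s i k) ≡ inj₂ (slot s i k)
  toSum-atSlot s i zero          = refl
  toSum-atSlot s i (suc zero)    = refl
  toSum-atSlot s i (suc (suc k)) = refl

  toSum-fromSum : ∀ u → toSum (fromSum u) ≡ u
  toSum-fromSum (inj₁ zero)          = refl
  toSum-fromSum (inj₁ (suc zero))    = refl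
  toSum-fromSum (inj₁ (suc (suc j))) = refl
  toSum-fromSum (inj₂ r)             =
    let s , r′ = remQuot {2} (n * (2 + d)) r
        i , k  = remQuot {n} (2 + d) r′
    in trans (toSum-atSlot s i k) (cong inj₂
         (trans (cong (combine s) (combine-remQuot {n} (2 + d) r′)) (combine-remQuot {2} (n * (2 + d)) r)))

  index : Node n d → Fin nodes
  index u = join (3 + d) _ (toSum u)

  node : Fin nodes → Node n d
  node v = fromSum (splitAt (3 + d) v)

  node-index : ∀ u → node (index u) ≡ u
  node-index u = trans (cong fromSum (splitAt-join (3 + d) _ (toSum u))) (fromSum-toSum u)

  index-node : ∀ v → index (node v) ≡ v
  index-node v = trans (cong (join (3 + d) _) (toSum-fromSum (splitAt (3 + d) v))) (join-splitAt (3 + d) _ v)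

  index-injective : ∀ {u v} → index u ≡ index v → u ≡ v
  index-injective {u} {v} eq = trans (sym (node-index u)) (trans (cong node eq) (node-index v))

  number : Node n d → ℕ
  number u = toℕ (index u)

  slotNumber : Fin 2 → Fin n → ℕ → ℕ
  slotNumber s i k = (3 + d) + (n * (2 + d) * toℕ s + ((2 + d) * toℕ i + k))

  number-coord : ∀ j → number (coord j) ≡ 2 + toℕ j
  number-coord j = cong (2 +_) (toℕ-↑ˡ j _)

  number-slot : ∀ s i k → toℕ ((3 + d) ↑ʳ slot s i k) ≡ slotNumber s i (toℕ k)
  number-slot s i k = trans (toℕ-↑ʳ (3 + d) _) (cong ((3 + d) +_)
    (trans (toℕ-combine s _) (cong (n * (2 + d) * toℕ s +_) (toℕ-combine i k))))

  number-vec : ∀ s i → number (vec s i) ≡ slotNumber s i 0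
  number-vec s i = number-slot s i zero

  number-pend : ∀ s i → number (pend s i) ≡ slotNumber s i 1
  number-pend s i = number-slot s i (suc zero)

  number-leaf : ∀ s i j → number (leaf s i j) ≡ slotNumber s i (2 + toℕ j)
  number-leaf s i j = number-slot s i (suc (suc j))

module OVGraph {n d : ℕ} (A B : Vec (Vec Bool d) n) where

  open Numbering n d public

  family : Fin 2 → Vec (Vec Bool d) n
  family zero       = A
  family (suc zero) = B

  bit : Fin 2 → Fin n → Fin d → Bool
  bit s i j = lookup (lookup (family s) i) j

  anchor : Fin 2 → Node n d
  anchor zero       = apex
  anchor (suc zero) = coord zero

  bitEdge : Fin 2 → Fin n → Fin d → Node n d × Node n d
  bitEdge s i j = if bit s i j then (coord (suc j) , vec s i) else (hub , leaf s i j)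

  bitEdges : Fin 2 → Fin n → Fin d → List (Node n d × Node n d)
  bitEdges s i j = (apex , leaf s i j) ∷ bitEdge s i j ∷ []

  vecEdges : Fin 2 → Fin n → List (Node n d × Node n d)
  vecEdges s i = (anchor s , vec s i) ∷ (vec s i , pend s i) ∷ ⋃ (bitEdges s i)

  hubEdge : Fin (suc d) → Node n d × Node n d
  hubEdge j = hub , coord j

  coordEdges : List (Node n d × Node n d)
  coordEdges = (apex , hub) ∷ tabulate hubEdge

  nodeEdges : List (Node n d × Node n d)
  nodeEdges = coordEdges ++ ⋃ (λ s → ⋃ (vecEdges s))

  data Edge : Node n d → Node n d → Set where
    apex-hub    : Edge apex hub
    hub-coord   : ∀ j → Edge hub (coord j)
    anchor-vec  : ∀ s i → Edge (anchor s) (vec s i)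
    vec-pend    : ∀ s i → Edge (vec s i) (pend s i)
    apex-leaf   : ∀ s i j → Edge apex (leaf s i j)
    coord-vec   : ∀ s i j → bit s i j ≡ true → Edge (coord (suc j)) (vec s i)
    hub-leaf    : ∀ s i j → bit s i j ≡ false → Edge hub (leaf s i j)

  bitEdge-Edge : ∀ s i j → uncurry Edge (bitEdge s i j)
  bitEdge-Edge s i j with bit s i j in eq
  ... | true  = coord-vec s i j eq
  ... | false = hub-leaf s i j eq

  nodeEdges-sound : All (uncurry Edge) nodeEdges
  nodeEdges-sound = Allₚ.++⁺ (apex-hub ∷ Allₚ.tabulate⁺ hub-coord)
    (⋃-All λ s → ⋃-All λ i → anchor-vec s i ∷ vec-pend s i ∷
      ⋃-All λ j → apex-leaf s i j ∷ bitEdge-Edge s i j ∷ [])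

  inBlock : ∀ {e} s i → e ∈ vecEdges s i → e ∈ nodeEdges
  inBlock s i e∈ = ∈-++⁺ʳ coordEdges (⋃-∈ {f = λ s → ⋃ (vecEdges s)} s (⋃-∈ i e∈))

  nodeEdges-complete : ∀ {u v} → Edge u v → (u , v) ∈ nodeEdges
  nodeEdges-complete apex-hub          = here refl
  nodeEdges-complete (hub-coord j)     = there (∈-++⁺ˡ (∈-tabulate⁺ {f = hubEdge} j))
  nodeEdges-complete (anchor-vec s i)  = inBlock s i (here refl)
  nodeEdges-complete (vec-pend s i)    = inBlock s i (there (here refl))
  nodeEdges-complete (apex-leaf s i j) = inBlock s i (there (there (⋃-∈ j (here refl))))
  nodeEdges-complete (coord-vec s i j b) = inBlock s i (there (there (⋃-∈ {f = bitEdges s i} j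
    (there (here (sym (cong (if_then (coord (suc j) , vec s i) else (hub , leaf s i j)) b)))))))
  nodeEdges-complete (hub-leaf s i j b) = inBlock s i (there (there (⋃-∈ {f = bitEdges s i} j
    (there (here (sym (cong (if_then (coord (suc j) , vec s i) else (hub , leaf s i j)) b)))))))

  -- Every edge of a block ends in a vector, pendant or leaf of that block, so its second endpoint
  -- reveals side and vector. Only `bitKey` also consults the first endpoint: it must tell a bit's
  -- edge into a vector from the anchor edge, which may start at `coord zero`.
  sideKey : Node n d × Node n d → Maybe (Fin 2)
  sideKey (_ , vec s _)    = just s
  sideKey (_ , pend s _)   = just s
  sideKey (_ , leaf s _ _) = just s
  sideKey (_ , _)          = nothing

  vectorKey : Node n d × Node n d → Maybe (Fin n)
  vectorKey (_ , vec _ i)    = just i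
  vectorKey (_ , pend _ i)   = just i
  vectorKey (_ , leaf _ i _) = just i
  vectorKey (_ , _)          = nothing

  bitKey : Node n d × Node n d → Maybe (Fin d)
  bitKey (_ , leaf _ _ j)            = just j
  bitKey (coord (suc j) , vec _ _)   = just j
  bitKey (_ , _)                     = nothing

  bitEdges-key : ∀ s i j → All (λ e → bitKey e ≡ just j) (bitEdges s i j)
  bitEdges-key s i j with bit s i j
  ... | true  = refl ∷ refl ∷ []
  ... | false = refl ∷ refl ∷ []

  vecEdges-vectorKey : ∀ s i → All (λ e → vectorKey e ≡ just i) (vecEdges s i)
  vecEdges-vectorKey s i = refl ∷ refl ∷ ⋃-All bits
    where
    bits : ∀ j → All (λ e → vectorKey e ≡ just i) (bitEdges s i j)
    bits j with bit s i j
    ... | true  = refl ∷ refl ∷ []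
    ... | false = refl ∷ refl ∷ []

  vecEdges-sideKey : ∀ s i → All (λ e → sideKey e ≡ just s) (vecEdges s i)
  vecEdges-sideKey s i = refl ∷ refl ∷ ⋃-All bits
    where
    bits : ∀ j → All (λ e → sideKey e ≡ just s) (bitEdges s i j)
    bits j with bit s i j
    ... | true  = refl ∷ refl ∷ []
    ... | false = refl ∷ refl ∷ []

  bitEdges-unique : ∀ s i j → Unique (bitEdges s i j)
  bitEdges-unique s i j with bit s i j
  ... | true  = ((λ ()) ∷ []) ∷ [] ∷ []
  ... | false = ((λ ()) ∷ []) ∷ [] ∷ []

  vecEdges-unique : ∀ s i → Unique (vecEdges s i)
  vecEdges-unique s i =
    ((λ ()) ∷ All.map (apart (anchor-key s)) keyed) ∷
    All.map (apart refl) keyed ∷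
    ⋃-unique bitKey (bitEdges-unique s i) (bitEdges-key s i)
    where
    keyed : All (λ e → ∃[ j ] bitKey e ≡ just j) (⋃ (bitEdges s i))
    keyed = ⋃-All λ j → All.map (j ,_) (bitEdges-key s i j)
    anchor-key : ∀ s → bitKey (anchor s , vec s i) ≡ nothing
    anchor-key zero       = refl
    anchor-key (suc zero) = refl
    apart : ∀ {e e′} → bitKey e ≡ nothing → ∃[ j ] bitKey e′ ≡ just j → e ≢ e′
    apart p (_ , q) refl with () ← trans (sym p) q

  nodeEdges-unique : Unique nodeEdges
  nodeEdges-unique = Uniqueₚ.++⁺
    (Allₚ.tabulate⁺ {f = hubEdge} (λ _ ()) ∷ Uniqueₚ.tabulate⁺ {f = hubEdge} λ {refl → refl})
    (⋃-unique sideKey (λ s → ⋃-unique vectorKey (vecEdges-unique s) (vecEdges-vectorKey s))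
      (λ s → ⋃-All (vecEdges-sideKey s)))
    (λ (e∈c , e∈v) → absurd (All.lookup unkeyed e∈c)
      (All.lookup {P = λ e → ∃[ s ] sideKey e ≡ just s}
        (⋃-All λ s → ⋃-All λ i → All.map (s ,_) (vecEdges-sideKey s i)) e∈v))
    where
    unkeyed : All (λ e → sideKey e ≡ nothing) coordEdges
    unkeyed = refl ∷ Allₚ.tabulate⁺ {f = hubEdge} (λ _ → refl)
    absurd : ∀ {e} → sideKey e ≡ nothing → ¬ (∃[ s ] sideKey e ≡ just s)
    absurd p (_ , q) with () ← trans (sym p) q

  -- The numbering is chosen for this: apex, hub and coordinates come first and a pendant directly
  -- follows its vector, so edges can be listed as they are constructed, without reorientation.
  Edge-ordered : ∀ {u v} → Edge u v → number u < number v
  Edge-ordered apex-hub      = z<s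
  Edge-ordered (hub-coord j) = s<s z<s
  Edge-ordered (anchor-vec zero i) = z<s
  Edge-ordered (anchor-vec (suc zero) i) rewrite number-vec (suc zero) i = s≤s (s≤s (s≤s z≤n))
  Edge-ordered (vec-pend s i) rewrite number-vec s i | number-pend s i =
    +-monoʳ-< (3 + d) (+-monoʳ-< (n * (2 + d) * toℕ s) (+-monoʳ-< ((2 + d) * toℕ i) z<s))
  Edge-ordered (apex-leaf s i j) = z<s
  Edge-ordered (coord-vec s i j _) rewrite number-vec s i | number-coord (suc j) =
    m≤n⇒m≤n+o _ (s≤s (s≤s (s≤s (toℕ<n j))))
  Edge-ordered (hub-leaf s i j _) = s<s z<s

  graph : Graph
  graph = record
    { order   = nodes
    ; edges   = map (λ (u , v) → index u , index v) nodeEdges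
    ; ordered = Allₚ.map⁺ (All.map Edge-ordered nodeEdges-sound)
    ; unique  = Uniqueₚ.map⁺ (λ eq → let p , q = ,-injective eq in
                  cong₂ _,_ (index-injective p) (index-injective q)) nodeEdges-unique
    }

  -- Walks, potentials and eccentricities

  open Graph graph using (Adjacent; Walk; []; _∷_; IsDistance)

  adjacent : ∀ {u v} → Edge u v → Adjacent (index u) (index v)
  adjacent e = inj₁ (∈-map⁺ _ (nodeEdges-complete e))

  adjacent⁻¹ : ∀ {u v} → Edge u v → Adjacent (index v) (index u)
  adjacent⁻¹ e = inj₂ (∈-map⁺ _ (nodeEdges-complete e))

  edge⁻ : ∀ {u v} → (u , v) ∈ edges graph → Edge (node u) (node v)
  edge⁻ uv∈ with (u , v) , e∈ , refl ← ∈-map⁻ _ uv∈ =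
    subst₂ Edge (sym (node-index u)) (sym (node-index v)) (All.lookup nodeEdges-sound e∈)

  Adjacent-sym : ∀ {u v} → Adjacent u v → Adjacent v u
  Adjacent-sym (inj₁ p) = inj₂ p
  Adjacent-sym (inj₂ p) = inj₁ p

  infixr 5 _◅◅_
  _◅◅_ : ∀ {u v x k l} → Walk u v k → Walk v x l → Walk u x (k + l)
  []      ◅◅ q = q
  (e ∷ p) ◅◅ q = e ∷ (p ◅◅ q)

  reverse : ∀ {u v k} → Walk u v k → ∃[ l ] Walk v u l
  reverse []      = 0 , []
  reverse (e ∷ p) = _ , proj₂ (reverse p) ◅◅ (Adjacent-sym e ∷ [])

  Within-distance : Node n d → Node n d → ℕ → Set
  Within-distance u v k = ∃[ l ] l ≤ k × Walk (index u) (index v) l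

  -- The hub serves as a centre: this yields connectedness, and also the upper bound 5 for vectors
  -- of A, which are two steps away from it.
  fromHub : ∀ u → Within-distance hub u 3
  fromHub apex      = 1 , s≤s z≤n , adjacent⁻¹ apex-hub ∷ []
  fromHub hub       = 0 , z≤n , []
  fromHub (coord j) = 1 , s≤s z≤n , adjacent (hub-coord j) ∷ []
  fromHub (vec zero i)        = 2 , s≤s (s≤s z≤n) , adjacent⁻¹ apex-hub ∷ adjacent (anchor-vec zero i) ∷ []
  fromHub (vec (suc zero) i)  = 2 , s≤s (s≤s z≤n) , adjacent (hub-coord zero) ∷ adjacent (anchor-vec (suc zero) i) ∷ []
  fromHub (pend zero i)       = 3 , ≤-refl ,
    adjacent⁻¹ apex-hub ∷ adjacent (anchor-vec zero i) ∷ adjacent (vec-pend zero i) ∷ []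
  fromHub (pend (suc zero) i) = 3 , ≤-refl ,
    adjacent (hub-coord zero) ∷ adjacent (anchor-vec (suc zero) i) ∷ adjacent (vec-pend (suc zero) i) ∷ []
  fromHub (leaf s i j) = 2 , s≤s (s≤s z≤n) , adjacent⁻¹ apex-hub ∷ adjacent (apex-leaf s i j) ∷ []

  connected : Connected graph
  connected u v = subst₂ (λ u v → ∃[ k ] Walk u v k) (index-node u) (index-node v)
    (_ , proj₂ (reverse (proj₂ (proj₂ (fromHub (node u))))) ◅◅ proj₂ (proj₂ (fromHub (node v))))

  toApex : ∀ i → Walk (index (vec zero i)) (index apex) 1
  toApex i = adjacent⁻¹ (anchor-vec zero i) ∷ []

  toHub : ∀ i → Walk (index (vec zero i)) (index hub) 2
  toHub i = adjacent⁻¹ (anchor-vec zero i) ∷ adjacent apex-hub ∷ []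

  within-5 : ∀ i u → Within-distance (vec zero i) u 5
  within-5 i u = let l , l≤3 , p = fromHub u in 2 + l , s≤s (s≤s l≤3) , toHub i ◅◅ p

  -- Difference at most 1, in Boolean form: between numerals it evaluates to the unit type, so the
  -- case analysis over edges is closed by `tt`.
  Near : ℕ → ℕ → Set
  Near k l = T ((k ≤ᵇ suc l) ∧ (l ≤ᵇ suc k))

  Near⇒≤ : ∀ k l → Near k l → k ≤ suc l × l ≤ suc k
  Near⇒≤ k l near = let p , q = Equivalence.to T-∧ near in ≤ᵇ⇒≤ k _ p , ≤ᵇ⇒≤ l _ q

  -- A 1-Lipschitz function on the graph. The difference of its values at two vertices bounds their
  -- distance from below.
  Potential : (Node n d → ℕ) → Set
  Potential φ = ∀ {u v} → Edge u v → Near (φ u) (φ v)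

  potential-bound : ∀ φ → Potential φ → ∀ {u v k} → Walk u v k → φ (node v) ≤ k + φ (node u)
  potential-bound φ pot []      = ≤-refl
  potential-bound φ pot {u} {x} {suc k} (_∷_ {v = v} e p) = begin
    φ (node x)           ≤⟨ potential-bound φ pot p ⟩
    k + φ (node v)       ≤⟨ +-monoʳ-≤ k (close e) ⟩
    k + suc (φ (node u)) ≡⟨ +-suc k _ ⟩
    suc k + φ (node u)   ∎
    where
    open ≤-Reasoning
    close : Adjacent u v → φ (node v) ≤ suc (φ (node u))
    close (inj₁ e∈) = proj₂ (Near⇒≤ (φ (node u)) (φ (node v)) (pot (edge⁻ e∈)))
    close (inj₂ e∈) = proj₁ (Near⇒≤ (φ (node v)) (φ (node u)) (pot (edge⁻ e∈)))

  -- Upper and lower bound meet: walks of length at most `e` reach every vertex, while the potential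
  -- forbids a shorter walk to the vertex where it takes the value `e`.
  eccentricity : ∀ φ → Potential φ → ∀ u e → φ u ≡ 0 →
                 (∀ v → Within-distance u v e) → ∃[ v ] φ v ≡ e → IsEccentricity graph (index u) e
  eccentricity φ pot u e φu≡0 within (v , φv≡e) = (index v , attained (within v) , far) , bounded
    where
    far : ∀ j → Walk (index u) (index v) j → e ≤ j
    far j p = subst₂ _≤_ (trans (cong φ (node-index v)) φv≡e)
      (trans (cong (j +_) (trans (cong φ (node-index u)) φu≡0)) (+-identityʳ j))
      (potential-bound φ pot p)
    attained : Within-distance u v e → Walk (index u) (index v) e
    -- The short walk cannot be shorter than `e`, so its length is exactly `e`.
    attained (l , l≤e , p) with refl ← ≤-antisym l≤e (far l p) = p
    bounded : ∀ v k → IsDistance (index u) v k → k ≤ e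
    bounded v k (_ , least) = let l , l≤e , p = within (node v) in
      ≤-trans (least l (subst (λ v → Walk (index u) v l) (index-node v) p)) l≤e

  -- A lower bound for the distance from the i-th vector of A, sharp on the
  -- chosen vectors β of B and their pendants.
  module _ (i : Fin n) (β : Fin n → Bool)
           (β-orthogonal : ∀ k j → β k ≡ true → bit zero i j ≡ true → bit (suc zero) k j ≡ false) where

    level : Node n d → ℕ
    level apex            = 1
    level hub             = 2
    level (coord zero)    = 3
    level (coord (suc j)) = if bit zero i j then 1 else 3
    level (vec zero i′)   = if does (i Finₚ.≟ i′) then 0 else 2
    level (pend zero i′)  = if does (i Finₚ.≟ i′) then 1 else 2
    level (vec (suc zero) k)  = if β k then 4 else 2
    level (pend (suc zero) k) = if β k then 5 else 2
    level (leaf s i′ j)   = 2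

    level-potential : Potential level
    level-potential apex-hub = tt
    level-potential (hub-coord zero) = tt
    level-potential (hub-coord (suc j)) with bit zero i j
    ... | true  = tt
    ... | false = tt
    level-potential (anchor-vec zero i′) with does (i Finₚ.≟ i′)
    ... | true  = tt
    ... | false = tt
    level-potential (anchor-vec (suc zero) k) with β k
    ... | true  = tt
    ... | false = tt
    level-potential (vec-pend zero i′) with does (i Finₚ.≟ i′)
    ... | true  = tt
    ... | false = tt
    level-potential (vec-pend (suc zero) k) with β k
    ... | true  = tt
    ... | false = tt
    level-potential (apex-leaf s i′ j) = tt
    level-potential (coord-vec zero i′ j b) with i Finₚ.≟ i′
    ... | yes refl rewrite b = tt
    ... | no _ with bit zero i j
    ...   | true  = tt
    ...   | false = tt
    level-potential (coord-vec (suc zero) k j b) with bit zero i j in a | β k in βk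
    -- An edge from level 1 to level 4 would break the potential; orthogonality excludes precisely
    -- this edge.
    ... | true  | true  with () ← trans (sym b) (β-orthogonal k j βk a)
    ... | true  | false = tt
    ... | false | true  = tt
    ... | false | false = tt
    level-potential (hub-leaf s i′ j _) = tt

    level-source : level (vec zero i) ≡ 0
    level-source with i Finₚ.≟ i
    ... | yes _  = refl
    ... | no i≢i = contradiction refl i≢i

  eccentricity-5 : ∀ i k → (∀ j → bit zero i j ≡ true → bit (suc zero) k j ≡ false) →
                   IsEccentricity graph (index (vec zero i)) 5
  eccentricity-5 i k ortho = eccentricity (level i β β-ortho) (level-potential i β β-ortho) (vec zero i) 5
    (level-source i β β-ortho) (within-5 i) (pend (suc zero) k , far)
    where
    β : Fin n → Bool
    -- Only `k` is raised, because other vectors of B may share a coordinate with the `i`-th vector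
    -- of A.
    β k′ = does (k Finₚ.≟ k′)
    β-ortho : ∀ k′ j → β k′ ≡ true → bit zero i j ≡ true → bit (suc zero) k′ j ≡ false
    β-ortho k′ j βk′ with k Finₚ.≟ k′
    ... | yes refl = ortho j
    β-ortho k′ j () | no _
    far : level i β β-ortho (pend (suc zero) k) ≡ 5
    far with k Finₚ.≟ k
    ... | yes _  = refl
    ... | no k≢k = contradiction refl k≢k

  -- With no vector of B raised, the largest level is 3. It is attained at `coord zero`, which is
  -- joined to no vector of A and so makes the eccentricity exactly 3.
  eccentricity-3 : ∀ i → (∀ k → ∃[ j ] bit zero i j ≡ true × bit (suc zero) k j ≡ true) →
                   IsEccentricity graph (index (vec zero i)) 3
  eccentricity-3 i meets = eccentricity (level i β β-ortho) (level-potential i β β-ortho) (vec zero i) 3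
    (level-source i β β-ortho) within-3 (coord zero , refl)
    where
    β : Fin n → Bool
    β _ = false
    β-ortho : ∀ k j → β k ≡ true → bit zero i j ≡ true → bit (suc zero) k j ≡ false
    β-ortho k j ()
    toVec : ∀ k → Walk (index (vec zero i)) (index (vec (suc zero) k)) 2
    toVec k = let j , a , b = meets k in adjacent⁻¹ (coord-vec zero i j a) ∷ adjacent (coord-vec (suc zero) k j b) ∷ []
    within-3 : ∀ u → Within-distance (vec zero i) u 3
    within-3 apex = 1 , s≤s z≤n , toApex i
    within-3 hub  = 2 , s≤s (s≤s z≤n) , toHub i
    within-3 (coord j) = 3 , ≤-refl , toHub i ◅◅ (adjacent (hub-coord j) ∷ [])
    within-3 (vec zero i′)  = 2 , s≤s (s≤s z≤n) , toApex i ◅◅ (adjacent (anchor-vec zero i′) ∷ [])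
    within-3 (pend zero i′) = 3 , ≤-refl ,
      toApex i ◅◅ (adjacent (anchor-vec zero i′) ∷ adjacent (vec-pend zero i′) ∷ [])
    within-3 (vec (suc zero) k)  = 2 , s≤s (s≤s z≤n) , toVec k
    within-3 (pend (suc zero) k) = 3 , ≤-refl , toVec k ◅◅ (adjacent (vec-pend (suc zero) k) ∷ [])
    within-3 (leaf s i′ j) = 2 , s≤s (s≤s z≤n) , toApex i ◅◅ (adjacent (apex-leaf s i′ j) ∷ [])

-- Counter programs and their compilation

Store : Set
Store = (Reg → ℕ) × (Addr → ℕ)

at : Label → Store → Config
at i (ρ , μ) = ⟨ i , ρ , μ ⟩

infixr 4 _⨾_
-- Loops are bounded: the counter's value on entry fixes the number of rounds. Semantics and running
-- time are therefore total functions, and straight-line code is verified by evaluating them.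
data Cmd : Set where
  instr : Instr → Cmd
  inc   : Reg → Cmd
  _⨾_   : Cmd → Cmd → Cmd
  for   : Reg → Cmd → Cmd

-- Register 15 is scratch.
incr decr : Reg → Store → Store
incr r (ρ , μ) = let ρ′ = ρ [ 15 ≔ 1 ] in ρ′ [ r ≔ ρ′ 15 + ρ′ r ] , μ
decr r (ρ , μ) = let ρ′ = ρ [ 15 ≔ 1 ] in ρ′ [ r ≔ ρ′ r ∸ ρ′ 15 ] , μ

execInstr : Instr → Store → Store
execInstr (const r v)  (ρ , μ) = ρ [ r ≔ v ] , μ
execInstr (op ⊕ r x y) (ρ , μ) = ρ [ r ≔ ⟦ ⊕ ⟧ (ρ x) (ρ y) ] , μ
execInstr (load r a)   (ρ , μ) = ρ [ r ≔ μ (ρ a) ] , μ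
execInstr (store a r)  (ρ , μ) = ρ , μ [ ρ a ≔ ρ r ]
execInstr _            σ       = σ

repeat : ℕ → (Store → Store) → Store → Store
repeat zero    f σ = σ
repeat (suc k) f σ = repeat k f (f σ)

-- Each round pays 1 for the test and 3 for loading 1, decrementing and jumping back; the final 1 is
-- the test that leaves the loop.
repeatCost : ℕ → (Store → Store) → (Store → ℕ) → Store → ℕ
repeatCost zero    f T σ = 1
repeatCost (suc k) f T σ = suc (T σ + (3 + repeatCost k f T (f σ)))

exec : Cmd → Store → Store
exec (instr i) σ = execInstr i σ
exec (inc r)   σ = incr r σ
exec (c ⨾ c′)  σ = exec c′ (exec c σ)
exec (for r c) σ = repeat (proj₁ σ r) (λ τ → decr r (exec c τ)) σ

cost : Cmd → Store → ℕ
cost (instr i) σ = 1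
cost (inc r)   σ = 2
cost (c ⨾ c′)  σ = cost c σ + cost c′ (exec c σ)
cost (for r c) σ = repeatCost (proj₁ σ r) (λ τ → decr r (exec c τ)) (cost c) σ

codeSize : Cmd → ℕ
codeSize (instr i) = 1
codeSize (inc r)   = 2
codeSize (c ⨾ c′)  = codeSize c + codeSize c′
codeSize (for r c) = suc (codeSize c + 3)

compile : Label → Cmd → List Instr
compile l (instr i) = i ∷ []
compile l (inc r)   = const 15 1 ∷ op add r 15 r ∷ []
compile l (c ⨾ c′)  = compile l c ++ compile (l + codeSize c) c′
compile l (for r c) = jumpz r (l + codeSize (for r c)) ∷
  compile (suc l) c ++ const 15 1 ∷ op sub r r 15 ∷ jump l ∷ []

length-compile : ∀ l c → length (compile l c) ≡ codeSize c
length-compile l (instr i) = refl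
length-compile l (inc r)   = refl
length-compile l (c ⨾ c′)  = trans (length-++ (compile l c)) (cong₂ _+_ (length-compile l c) (length-compile _ c′))
length-compile l (for r c) = cong suc (trans (length-++ (compile (suc l) c)) (cong (_+ 3) (length-compile (suc l) c)))

writesInstr : Instr → Reg → Bool
writesInstr (const r _)  q = q ≡ᵇ r
writesInstr (op _ r _ _) q = q ≡ᵇ r
writesInstr (load r _)   q = q ≡ᵇ r
writesInstr _            q = false

keeps : Cmd → Reg → Bool
keeps (instr i) q = not (writesInstr i q)
keeps (inc r)   q = not (q ≡ᵇ 15) ∧ not (q ≡ᵇ r)
keeps (c ⨾ c′)  q = keeps c q ∧ keeps c′ q
keeps (for r c) q = keeps c q ∧ (not (q ≡ᵇ 15) ∧ not (q ≡ᵇ r))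

-- Instructions that leave the control flow alone and produce no value above 4
-- and above all values already present.  Only inc exceeds the old maximum, and
-- by at most 1, so the running time bounds all words and excludes overflow.
tameInstr : Instr → Bool
tameInstr (const _ v)     = v ≤ᵇ 4
tameInstr (op sub _ _ _)  = true
tameInstr (op quot _ _ _) = true
tameInstr (load _ _)      = true
tameInstr (store _ _)     = true
tameInstr _               = false

tame : Cmd → Bool
tame (instr i) = tameInstr i
tame (inc r)   = true
tame (c ⨾ c′)  = tame c ∧ tame c′
-- The compiled loop tests the live counter, whereas `exec` reads it once. They agree only if the
-- body preserves the counter and the counter is not the scratch register.
tame (for r c) = tame c ∧ keeps c r ∧ not (r ≡ᵇ 15)

∧-elim : ∀ {a b} → T (a ∧ b) → T a × T b
∧-elim = Equivalence.to T-∧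

≔-other : ∀ (f : ℕ → ℕ) {i v q} → T (not (q ≡ᵇ i)) → (f [ i ≔ v ]) q ≡ f q
≔-other f {i} {v} {q} q≢i with q ≡ᵇ i
... | false = refl

≔-same : ∀ (f : ℕ → ℕ) i {v} → (f [ i ≔ v ]) i ≡ v
≔-same f i with i ≡ᵇ i in eq
... | true  = refl
... | false = contradiction (≡⇒≡ᵇ i i refl) (subst T eq)

≔-≤ : ∀ {f : ℕ → ℕ} {i v B} → (∀ j → f j ≤ B) → v ≤ B → ∀ j → (f [ i ≔ v ]) j ≤ B
≔-≤ {i = i} f≤B v≤B j with j ≡ᵇ i
... | true  = v≤B
... | false = f≤B j

keeps-incr : ∀ r q σ → T (not (q ≡ᵇ 15) ∧ not (q ≡ᵇ r)) → proj₁ (incr r σ) q ≡ proj₁ σ q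
keeps-incr r q (ρ , μ) k = let k₁ , k₂ = ∧-elim {not (q ≡ᵇ 15)} k in
  trans (≔-other (ρ [ 15 ≔ 1 ]) k₂) (≔-other ρ k₁)

keeps-decr : ∀ r q σ → T (not (q ≡ᵇ 15) ∧ not (q ≡ᵇ r)) → proj₁ (decr r σ) q ≡ proj₁ σ q
keeps-decr r q (ρ , μ) k = let k₁ , k₂ = ∧-elim {not (q ≡ᵇ 15)} k in
  trans (≔-other (ρ [ 15 ≔ 1 ]) k₂) (≔-other ρ k₁)

keeps-exec : ∀ c q σ → T (keeps c q) → proj₁ (exec c σ) q ≡ proj₁ σ q
keeps-exec (instr (const r v))  q (ρ , μ) k = ≔-other ρ k
keeps-exec (instr (op ⊕ r x y)) q (ρ , μ) k = ≔-other ρ k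
keeps-exec (instr (load r a))   q (ρ , μ) k = ≔-other ρ k
keeps-exec (instr (store a r))  q σ k = refl
keeps-exec (instr (jump _))     q σ k = refl
keeps-exec (instr (jumpz _ _))  q σ k = refl
keeps-exec (instr halt)         q σ k = refl
keeps-exec (inc r)   q σ k = keeps-incr r q σ k
keeps-exec (c ⨾ c′)  q σ k = let k₁ , k₂ = ∧-elim {keeps c q} k in
  trans (keeps-exec c′ q (exec c σ) k₂) (keeps-exec c q σ k₁)
keeps-exec (for r c) q σ k = go (proj₁ σ r) σ
  where
  go : ∀ m τ → proj₁ (repeat m (λ τ → decr r (exec c τ)) τ) q ≡ proj₁ τ q
  go zero    τ = refl
  go (suc m) τ = let k₁ , k₂ = ∧-elim {keeps c q} k in
    trans (go m _) (trans (keeps-decr r q (exec c τ) k₂) (keeps-exec c q τ k₁))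

Bounded : ℕ → Store → Set
Bounded B (ρ , μ) = (∀ r → ρ r ≤ B) × (∀ a → μ a ≤ B)

Bounded-mono : ∀ {B B′ σ} → B ≤ B′ → Bounded B σ → Bounded B′ σ
Bounded-mono B≤B′ (ρ≤B , μ≤B) = (λ r → ≤-trans (ρ≤B r) B≤B′) , (λ a → ≤-trans (μ≤B a) B≤B′)

quot-≤ : ∀ x y → ⟦ quot ⟧ x y ≤ x
quot-≤ x zero      = z≤n
quot-≤ x y@(suc _) = m/n≤m x y

tame-≤ : ∀ i {B σ} → T (tameInstr i) → 4 ≤ B → Bounded B σ → Bounded B (execInstr i σ)
tame-≤ (const r v) v≤4 4≤B (ρ≤ , μ≤) = ≔-≤ {i = r} ρ≤ (≤-trans (≤ᵇ⇒≤ v 4 v≤4) 4≤B) , μ≤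
tame-≤ (op sub r x y) {σ = ρ , _} _ _ (ρ≤ , μ≤) = ≔-≤ {i = r} ρ≤ (≤-trans (m∸n≤m (ρ x) (ρ y)) (ρ≤ x)) , μ≤
tame-≤ (op quot r x y) {σ = ρ , _} _ _ (ρ≤ , μ≤) = ≔-≤ {i = r} ρ≤ (≤-trans (quot-≤ (ρ x) (ρ y)) (ρ≤ x)) , μ≤
tame-≤ (load r a)  _ _ (ρ≤ , μ≤) = ≔-≤ {i = r} ρ≤ (μ≤ _) , μ≤
tame-≤ (store a r) {σ = ρ , _} _ _ (ρ≤ , μ≤) = ρ≤ , ≔-≤ {i = ρ a} μ≤ (ρ≤ r)

record CodeAt (Q : Program) (l : Label) (is : List Instr) : Set where
  constructor codeAt
  field fetch : ∀ j i → is ‼ j ≡ just i → Q ‼ (l + j) ≡ just i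
open CodeAt

‼-++ˡ : ∀ {A : Set} (xs ys : List A) j {x} → xs ‼ j ≡ just x → (xs ++ ys) ‼ j ≡ just x
‼-++ˡ (x ∷ xs) ys zero    eq = eq
‼-++ˡ (x ∷ xs) ys (suc j) eq = ‼-++ˡ xs ys j eq
‼-++ˡ [] ys zero ()
‼-++ˡ [] ys (suc j) ()

‼-++ʳ : ∀ {A : Set} (xs ys : List A) j → (xs ++ ys) ‼ (length xs + j) ≡ ys ‼ j
‼-++ʳ []       ys j = refl
‼-++ʳ (x ∷ xs) ys j = ‼-++ʳ xs ys j

CodeAt-left : ∀ {Q l is js} → CodeAt Q l (is ++ js) → CodeAt Q l is
CodeAt-left {is = is} {js} C .fetch j i eq = fetch C j i (‼-++ˡ is js j eq)

CodeAt-right : ∀ {Q l is js} → CodeAt Q l (is ++ js) → CodeAt Q (l + length is) js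
CodeAt-right {Q} {l} {is} {js} C .fetch j i eq = trans (cong (Q ‼_) (+-assoc l (length is) j))
  (fetch C (length is + j) i (trans (‼-++ʳ is js j) eq))

CodeAt-head : ∀ {Q l i is} → CodeAt Q l (i ∷ is) → Q ‼ l ≡ just i
CodeAt-head {Q} {l} C = trans (cong (Q ‼_) (sym (+-identityʳ l))) (fetch C 0 _ refl)

CodeAt-tail : ∀ {Q l i is} → CodeAt Q l (i ∷ is) → CodeAt Q (suc l) is
CodeAt-tail {Q} {l} C .fetch j i eq = trans (cong (Q ‼_) (sym (+-suc l j))) (fetch C (suc j) i eq)

module Running (w : ℕ) (Q : Program) where

  open Machine w Q

  infixr 5 _⟫_
  _⟫_ : ∀ {s s′ s″ t t′} → s ⟶[ t ] s′ → s′ ⟶[ t′ ] s″ → s ⟶[ t + t′ ] s″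
  done     ⟫ q = q
  step e p ⟫ q = step e (p ⟫ q)

  instr-step : ∀ i {l σ B} → T (tameInstr i) → 4 ≤ B → B < 2 ^ w → Bounded B σ →
               Q ‼ l ≡ just i → at l σ ⟶ at (suc l) (execInstr i σ)
  instr-step (const r v) v≤4 4≤B B< bd eq = const eq (≤-<-trans (≤-trans (≤ᵇ⇒≤ v 4 v≤4) 4≤B) B<)
  instr-step (op sub r x y) {σ = ρ , _} _ _ B< (ρ≤ , μ≤) eq =
    op eq (≤-<-trans (≤-trans (m∸n≤m (ρ x) (ρ y)) (ρ≤ x)) B<)
  instr-step (op quot r x y) {σ = ρ , _} _ _ B< (ρ≤ , μ≤) eq =
    op eq (≤-<-trans (≤-trans (quot-≤ (ρ x) (ρ y)) (ρ≤ x)) B<)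
  instr-step (load r a)  _ _ B< (ρ≤ , μ≤) eq = load eq (≤-<-trans (μ≤ _) B<)
  instr-step (store a r) _ _ B< _ eq = store eq

  Correct : Cmd → Store → ℕ → ℕ → Label → Set
  Correct c σ t B l = at l σ ⟶[ t ] at (l + codeSize c) (exec c σ) × Bounded (t + B) (exec c σ)

  compile-correct : ∀ c {l σ B} → T (tame c) → CodeAt Q l (compile l c) →
                    4 ≤ B → Bounded B σ → cost c σ + B < 2 ^ w → Correct c σ (cost c σ) B l
  compile-correct (instr i) {l} {σ} {B} ok C 4≤B bd B< =
    subst (λ l′ → at l σ ⟶[ 1 ] at l′ (execInstr i σ)) (+-comm 1 l)
      (step (instr-step i ok 4≤B (<-trans (n<1+n B) B<) bd (CodeAt-head C)) done) ,
    Bounded-mono (n≤1+n B) (tame-≤ i ok 4≤B bd)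
  compile-correct (inc r) {l} {σ@(ρ , μ)} {B} ok C 4≤B bd@(ρ≤ , μ≤) B< =
    subst (λ l′ → at l σ ⟶[ 2 ] at l′ (incr r σ)) (+-comm 2 l)
      (step (const (CodeAt-head C) (≤-<-trans (m≤m+n 1 (suc B)) B<))
        (step (op (CodeAt-head (CodeAt-tail C)) (≤-<-trans new≤ (<-trans (n<1+n _) B<))) done)) ,
    Bounded-mono (n≤1+n (suc B))
      (≔-≤ {i = r} (λ q → ≤-trans (ρ′≤ q) (n≤1+n B)) new≤ , λ a → ≤-trans (μ≤ a) (n≤1+n B))
    where
    ρ′ : Reg → ℕ
    ρ′ = ρ [ 15 ≔ 1 ]
    ρ′≤ : ∀ q → ρ′ q ≤ B
    ρ′≤ = ≔-≤ {i = 15} ρ≤ (≤-trans (s≤s z≤n) 4≤B)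
    new≤ : 1 + ρ′ r ≤ suc B
    new≤ = s≤s (ρ′≤ r)
  compile-correct (c ⨾ c′) {l} {σ} {B} ok C 4≤B bd B< =
    let ok₁ , ok₂ = ∧-elim {tame c} ok
        eq = +-assoc (cost c′ (exec c σ)) (cost c σ) B
        eq′ : cost (c ⨾ c′) σ + B ≡ cost c′ (exec c σ) + (cost c σ + B)
        eq′ = trans (cong (_+ B) (+-comm (cost c σ) _)) eq
        B<′ = subst (_< 2 ^ w) eq′ B<
        run₁ , bd₁ = compile-correct c {l} {σ} ok₁ (CodeAt-left C) 4≤B bd (≤-<-trans (m≤n+m _ (cost c′ (exec c σ))) B<′)
        run₂ , bd₂ = compile-correct c′ {l + codeSize c} {exec c σ} ok₂
          (subst (λ m → CodeAt Q (l + m) (compile (l + codeSize c) c′)) (length-compile l c)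
            (CodeAt-right {is = compile l c} C))
          (≤-trans 4≤B (m≤n+m B _)) bd₁ B<′
    in subst (λ l′ → at l σ ⟶[ cost c σ + cost c′ (exec c σ) ] at l′ (exec c′ (exec c σ)))
         (+-assoc l (codeSize c) (codeSize c′)) (run₁ ⟫ run₂) ,
       subst (λ b → Bounded b (exec c′ (exec c σ))) (sym eq′) bd₂
  compile-correct (for r c) {l} {σ} {B} ok C 4≤B bd B< = go (proj₁ σ r) σ B refl 4≤B bd B<
    where
    body : Store → Store
    body τ = decr r (exec c τ)

    ok₁ : T (tame c)
    ok₁ = proj₁ (∧-elim {tame c} ok)
    ok₂ : T (keeps c r)
    ok₂ = proj₁ (∧-elim {keeps c r} (proj₂ (∧-elim {tame c} ok)))
    ok₃ : T (not (r ≡ᵇ 15))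
    ok₃ = proj₂ (∧-elim {keeps c r} (proj₂ (∧-elim {tame c} ok)))

    tail : CodeAt Q (suc l + codeSize c) (const 15 1 ∷ op sub r r 15 ∷ jump l ∷ [])
    tail = subst (λ m → CodeAt Q (suc l + m) (const 15 1 ∷ op sub r r 15 ∷ jump l ∷ []))
      (length-compile (suc l) c) (CodeAt-right {is = compile (suc l) c} (CodeAt-tail C))

    counter : ∀ {m} τ → proj₁ τ r ≡ suc m → proj₁ (body τ) r ≡ m
    counter τ eq = let ρ = proj₁ (exec c τ) in trans (≔-same (ρ [ 15 ≔ 1 ]) r)
      (cong pred (trans (≔-other ρ ok₃) (trans (keeps-exec c r τ ok₂) eq)))

    go : ∀ m τ B → proj₁ τ r ≡ m → 4 ≤ B → Bounded B τ →
         repeatCost m body (cost c) τ + B < 2 ^ w →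
         at l τ ⟶[ repeatCost m body (cost c) τ ] at (l + codeSize (for r c)) (repeat m body τ) ×
         Bounded (repeatCost m body (cost c) τ + B) (repeat m body τ)
    go zero    τ B eq 4≤B bd B< = step (jumpz-taken (CodeAt-head C) eq) done , Bounded-mono (n≤1+n B) bd
    go (suc m) τ B eq 4≤B bd B< =
      step (jumpz-skipped (CodeAt-head C) (λ eq′ → contradiction (trans (sym eq′) eq) λ ()))
        (run₁ ⟫
        step (const (CodeAt-head tail) (≤-<-trans (≤-trans (s≤s z≤n) 4≤B′) B′<))
        (step (op (CodeAt-head (CodeAt-tail tail)) (≤-<-trans new≤ B′<))
        (step (jump (CodeAt-head (CodeAt-tail (CodeAt-tail tail)))) run₂))) ,
      Bounded-mono (≤-reflexive (solve-bound rest (cost c τ) B)) bd₂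
      where
      rest = repeatCost m body (cost c) (body τ)
      solve-bound : ∀ x y z → x + (4 + (y + z)) ≡ suc (y + (3 + x)) + z
      solve-bound x y z = begin
        x + (4 + (y + z)) ≡⟨ +-comm x _ ⟩
        4 + (y + z) + x   ≡⟨ cong (4 +_) (+-assoc y z x) ⟩
        4 + (y + (z + x)) ≡⟨ cong (λ u → 4 + (y + u)) (+-comm z x) ⟩
        4 + (y + (x + z)) ≡⟨ cong (4 +_) (+-assoc y x z) ⟨
        4 + (y + x + z)   ≡⟨ cong (λ u → suc (u + z)) (trans (+-comm 3 (y + x)) (trans (+-assoc y x 3) (cong (y +_) (+-comm x 3)))) ⟩
        suc (y + (3 + x)) + z ∎
        where open ≡-Reasoning
      total< : rest + (4 + (cost c τ + B)) < 2 ^ w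
      total< = subst (_< 2 ^ w) (sym (solve-bound rest (cost c τ) B)) B<
      B′< : cost c τ + B < 2 ^ w
      B′< = ≤-<-trans (≤-trans (m≤n+m _ 4) (m≤n+m _ rest)) total<
      4≤B′ : 4 ≤ cost c τ + B
      4≤B′ = ≤-trans 4≤B (m≤n+m B _)
      first : Correct c τ (cost c τ) B (suc l)
      first = compile-correct c ok₁ (CodeAt-left (CodeAt-tail C)) 4≤B bd B′<
      run₁ = proj₁ first
      ρ′≤ : ∀ q → (proj₁ (exec c τ) [ 15 ≔ 1 ]) q ≤ cost c τ + B
      ρ′≤ = ≔-≤ {i = 15} (proj₁ (proj₂ first)) (≤-trans (s≤s z≤n) 4≤B′)
      new≤ : (proj₁ (exec c τ) [ 15 ≔ 1 ]) r ∸ 1 ≤ cost c τ + B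
      new≤ = ≤-trans (m∸n≤m _ 1) (ρ′≤ r)
      second : at l (body τ) ⟶[ rest ] at (l + codeSize (for r c)) (repeat m body (body τ)) ×
               Bounded (rest + (4 + (cost c τ + B))) (repeat m body (body τ))
      second = go m (body τ) (4 + (cost c τ + B)) (counter τ eq) (≤-trans 4≤B′ (m≤n+m _ 4))
        (Bounded-mono (m≤n+m _ 4) (≔-≤ {i = r} ρ′≤ new≤ , proj₂ (proj₂ first)))
        total<
      run₂ = proj₁ second
      bd₂ = proj₂ second

-- Running a relocated program

≡ᵇ-+ : ∀ b m n → (b + m ≡ᵇ b + n) ≡ (m ≡ᵇ n)
≡ᵇ-+ zero    m n = refl
≡ᵇ-+ (suc b) m n = ≡ᵇ-+ b m n

≔-shift : ∀ b (f g : ℕ → ℕ) {i v u} → (∀ j → f (b + j) ≡ g j) → v ≡ u →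
          ∀ j → (f [ b + i ≔ v ]) (b + j) ≡ (g [ i ≔ u ]) j
≔-shift b f g {i} f≗g v≡u j rewrite ≡ᵇ-+ b j i with j ≡ᵇ i
... | true  = v≡u
... | false = f≗g j

≔-< : ∀ {f : ℕ → ℕ} {i v B} → (∀ j → f j < B) → v < B → ∀ j → (f [ i ≔ v ]) j < B
≔-< {i = i} f<B v<B j with j ≡ᵇ i
... | true  = v<B
... | false = f<B j

-- The guest's registers are shifted by 16 and its memory by the contents of
-- register 2; every guest instruction becomes two host instructions.
module Guest (L exit : Label) where

  -- Only memory accesses need an address computed in advance. All other instructions get a filler,
  -- so that a label `l` uniformly becomes `L + l * 2`.
  prepare : Instr → Instr
  prepare (load r a)  = op add 15 2 (16 + a)
  prepare (store a r) = op add 15 2 (16 + a)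
  prepare _           = const 15 0

  perform : Instr → Instr
  perform (const r v)  = const (16 + r) v
  perform (op ⊕ r x y) = op ⊕ (16 + r) (16 + x) (16 + y)
  perform (load r a)   = load (16 + r) 15
  perform (store a r)  = store 15 (16 + r)
  perform (jump l)     = jump (L + l * 2)
  perform (jumpz r l)  = jumpz (16 + r) (L + l * 2)
  perform halt         = jump exit

  translate : Program → List Instr
  translate []      = []
  translate (i ∷ P) = prepare i ∷ perform i ∷ translate P

  translate-fetch : ∀ P j {i} → P ‼ j ≡ just i →
    translate P ‼ (j * 2) ≡ just (prepare i) × translate P ‼ (suc (j * 2)) ≡ just (perform i)
  translate-fetch (_ ∷ P) zero refl = refl , refl
  translate-fetch (_ ∷ P) (suc j) eq = translate-fetch P j eq
  translate-fetch [] zero ()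
  translate-fetch [] (suc j) ()

  length-translate : ∀ P → length (translate P) ≡ length P * 2
  length-translate []      = refl
  length-translate (_ ∷ P) = cong (2 +_) (length-translate P)

  module Simulation (w′ w : ℕ) (P Q : Program) (code : CodeAt Q L (translate P))
                    (n d b B : ℕ) (word≤B : 2 ^ w′ + b ≤ B) (B< : B < 2 ^ w) where

    open Running w Q using (_⟫_)
    private
      module Host = Machine w Q
      module Inner = Machine w′ P

    -- `words` bounds the shifted addresses, which must themselves fit in a host word. Registers 0
    -- to 2 lie below the guest's registers and carry the sizes and the base across to the readout.
    record Simulates (s : Config) (σ : Store) : Set where
      constructor simulates
      field
        registers : ∀ r → proj₁ σ (16 + r) ≡ reg s r
        memory    : ∀ a → proj₂ σ (b + a) ≡ mem s a
        words     : ∀ r → reg s r < 2 ^ w′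
        reg0      : proj₁ σ 0 ≡ n
        reg1      : proj₁ σ 1 ≡ d
        reg2      : proj₁ σ 2 ≡ b
        bounded   : Bounded B σ

    locate : ℕ → Label
    locate i = L + i * 2

    locate-suc : ∀ i → suc (suc (locate i)) ≡ locate (suc i)
    locate-suc i = sym (trans (+-suc L _) (cong suc (+-suc L _)))

    fetchPrepare : ∀ i {ins} → P ‼ i ≡ just ins → Q ‼ locate i ≡ just (prepare ins)
    fetchPrepare i eq = fetch code (i * 2) _ (proj₁ (translate-fetch P i eq))

    fetchPerform : ∀ i {ins} → P ‼ i ≡ just ins → Q ‼ suc (locate i) ≡ just (perform ins)
    fetchPerform i eq = trans (cong (Q ‼_) (sym (+-suc L (i * 2))))
      (fetch code (suc (i * 2)) _ (proj₂ (translate-fetch P i eq)))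

    fits : ∀ {v} → v ≤ B → v < 2 ^ w
    fits v≤B = ≤-<-trans v≤B B<

    word≤ : ∀ {v} → v < 2 ^ w′ → v ≤ B
    word≤ v< = ≤-trans (<⇒≤ v<) (≤-trans (m≤m+n _ b) word≤B)

    address≤ : ∀ {s σ} → Simulates s σ → ∀ a → proj₁ σ 2 + proj₁ σ (16 + a) ≤ B
    address≤ {s} {σ} S a = begin
      proj₁ σ 2 + proj₁ σ (16 + a) ≡⟨ cong₂ _+_ reg2 (registers a) ⟩
      b + reg s a                  ≡⟨ +-comm b _ ⟩
      reg s a + b                  ≤⟨ +-monoˡ-≤ b (<⇒≤ (words a)) ⟩
      2 ^ w′ + b                   ≤⟨ word≤B ⟩
      B                            ∎
      where
      open ≤-Reasoning
      open Simulates S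

    scratch : ∀ {s ρ μ v} → Simulates s (ρ , μ) → v ≤ B → Simulates s (ρ [ 15 ≔ v ] , μ)
    scratch (simulates regs mems ws r0 r1 r2 (ρ≤ , μ≤)) v≤B =
      simulates regs mems ws r0 r1 r2 (≔-≤ {i = 15} ρ≤ v≤B , μ≤)

    assign : ∀ {i j ρ′ μ′ ρ μ v u} r → Simulates ⟨ i , ρ′ , μ′ ⟩ (ρ , μ) → v ≡ u → u < 2 ^ w′ →
             Simulates ⟨ j , ρ′ [ r ≔ u ] , μ′ ⟩ (ρ [ 16 + r ≔ v ] , μ)
    assign {ρ′ = ρ′} {ρ = ρ} r (simulates regs mems ws r0 r1 r2 (ρ≤ , μ≤)) v≡u u< =
      simulates (≔-shift 16 ρ ρ′ regs v≡u) mems (≔-< {i = r} ws u<) r0 r1 r2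
        (≔-≤ {i = 16 + r} ρ≤ (subst (_≤ B) (sym v≡u) (word≤ u<)) , μ≤)

    redirect : ∀ {i j ρ′ μ′ σ} → Simulates ⟨ i , ρ′ , μ′ ⟩ σ → Simulates ⟨ j , ρ′ , μ′ ⟩ σ
    redirect (simulates regs mems ws r0 r1 r2 bd) = simulates regs mems ws r0 r1 r2 bd

    Advances : Label → Config → Store → ℕ → Set
    Advances i s′ σ t = ∃[ σ′ ] (at (locate i) σ Host.⟶[ t ] at (locate (pc s′)) σ′) × Simulates s′ σ′

    fallThrough : ∀ {i ρ′ μ′ σ σ₁ σ₂} → at (locate i) σ Host.⟶ at (suc (locate i)) σ₁ →
                  at (suc (locate i)) σ₁ Host.⟶ at (suc (suc (locate i))) σ₂ →
                  Simulates ⟨ suc i , ρ′ , μ′ ⟩ σ₂ → Advances i ⟨ suc i , ρ′ , μ′ ⟩ σ 2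
    fallThrough {i} {σ = σ} {σ₂ = σ₂} e₁ e₂ S = σ₂ ,
      subst (λ l → at (locate i) σ Host.⟶[ 2 ] at l σ₂) (locate-suc i) (Host.step e₁ (Host.step e₂ Host.done)) , S

    filler : ∀ i {ins σ} → P ‼ i ≡ just ins → prepare ins ≡ const 15 0 →
             at (locate i) σ Host.⟶ at (suc (locate i)) (proj₁ σ [ 15 ≔ 0 ] , proj₂ σ)
    filler i eq p = Host.const (trans (fetchPrepare i eq) (cong just p)) (fits z≤n)

    simulateStep : ∀ {s s′ σ} → s Inner.⟶ s′ → Simulates s σ → Advances (pc s) s′ σ 2
    simulateStep {⟨ i , _ , _ ⟩} (Inner.const {r = r} eq v<) S =
      fallThrough (filler i eq refl) (Host.const (fetchPerform i eq) (fits (word≤ v<)))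
        (assign {i} r (scratch S z≤n) refl v<)
    simulateStep {⟨ i , _ , _ ⟩} {σ = σ} (Inner.op {⊕ = ⊕} {r} {x} {y} eq v<) S =
      fallThrough (filler i eq refl) (Host.op (fetchPerform i eq) (fits (subst (_≤ B) (sym same) (word≤ v<))))
        (assign {i} r (scratch S z≤n) same v<)
      where same = cong₂ ⟦ ⊕ ⟧ (Simulates.registers S x) (Simulates.registers S y)
    simulateStep {⟨ i , _ , _ ⟩} {σ = ρ , μ} (Inner.load {μ = μ′} {r} {a} eq v<) S =
      fallThrough (Host.op (fetchPrepare i eq) (fits (address≤ S a)))
        (Host.load (fetchPerform i eq) (fits (subst (_≤ B) (sym same) (word≤ v<))))
        (assign {i} r (scratch S (address≤ S a)) same v<)
      where
      open Simulates S
      same : μ (ρ 2 + ρ (16 + a)) ≡ _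
      same = trans (cong μ (cong₂ _+_ reg2 (registers a))) (memory _)
    simulateStep {⟨ i , _ , _ ⟩} {σ = ρ , μ} (Inner.store {μ = μ′} {a} {r} eq) S =
      fallThrough (Host.op (fetchPrepare i eq) (fits (address≤ S a)))
        (Host.store (fetchPerform i eq))
        (simulates registers stored words reg0 reg1 reg2
          (≔-≤ {i = 15} (proj₁ bounded) (address≤ S a) , ≔-≤ {i = ρ 2 + ρ (16 + a)} (proj₂ bounded) (proj₁ bounded _)))
      where
      open Simulates S
      stored : ∀ q → (μ [ ρ 2 + ρ (16 + a) ≔ ρ (16 + r) ]) (b + q) ≡ (μ′ [ _ ≔ _ ]) q
      stored rewrite reg2 | registers a = ≔-shift b μ μ′ memory (registers r)
    simulateStep {⟨ i , _ , _ ⟩} (Inner.jump eq) S = _ ,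
      Host.step (filler i eq refl) (Host.step (Host.jump (fetchPerform i eq)) Host.done) ,
      redirect {i} (scratch S z≤n)
    simulateStep {⟨ i , _ , _ ⟩} (Inner.jumpz-taken {r = r} eq z) S = _ ,
      Host.step (filler i eq refl)
        (Host.step (Host.jumpz-taken (fetchPerform i eq) (trans (Simulates.registers S r) z)) Host.done) ,
      redirect {i} (scratch S z≤n)
    simulateStep {⟨ i , _ , _ ⟩} (Inner.jumpz-skipped {r = r} eq nz) S =
      fallThrough (filler i eq refl)
        (Host.jumpz-skipped (fetchPerform i eq) (λ z → nz (trans (sym (Simulates.registers S r)) z)))
        (redirect {i} (scratch S z≤n))

    simulate : ∀ {s s′ t σ} → s Inner.⟶[ t ] s′ → Simulates s σ → Advances (pc s) s′ σ (t * 2)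
    simulate Inner.done       S = _ , Host.done , S
    simulate (Inner.step e p) S =
      let σ₁ , run₁ , S₁ = simulateStep e S
          σ₂ , run₂ , S₂ = simulate p S₁
      in σ₂ , run₁ ⟫ run₂ , S₂

    -- The additional two steps are the translation of `halt`: a filler and the jump to `exit`.
    simulateHalting : ∀ {s s′ t σ} → s Inner.⟶[ t ] s′ → Inner.Halted s′ → Simulates s σ →
      ∃[ σ′ ] (at (locate (pc s)) σ Host.⟶[ t * 2 + 2 ] at exit σ′) × Simulates s′ σ′
    simulateHalting {s′ = s′} run halted S =
      let σ₁ , run₁ , S₁ = simulate run S
      in _ , run₁ ⟫ Host.step (filler (pc s′) halted refl) (Host.step (Host.jump (fetchPerform (pc s′) halted)) Host.done) , redirect (scratch S₁ z≤n)

-- Writing the graph and reading the estimates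

cell : List ℕ → ℕ → ℕ
cell xs i = fromMaybe 0 (xs ‼ i)

cell-[] : ∀ i → cell [] i ≡ 0
cell-[] zero    = refl
cell-[] (suc i) = refl

cell-snoc : ∀ xs x i → (cell xs [ length xs ≔ x ]) i ≡ cell (xs ++ x ∷ []) i
cell-snoc []       x zero    = refl
cell-snoc []       x (suc i) = sym (cell-[] i)
cell-snoc (y ∷ xs) x zero    = refl
cell-snoc (y ∷ xs) x (suc i) = cell-snoc xs x i

writes : (ℕ → ℕ) → ℕ → List ℕ → ℕ → ℕ
writes μ p []       = μ
writes μ p (x ∷ xs) = writes (μ [ p ≔ x ]) (suc p) xs

writes-after : ∀ b xs ys {μ p} → (∀ i → μ (b + i) ≡ cell ys i) → p ≡ b + length ys →
               ∀ i → writes μ p xs (b + i) ≡ cell (ys ++ xs) i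
writes-after b []       ys out p≡ i = trans (out i) (cong (λ zs → cell zs i) (sym (++-identityʳ ys)))
writes-after b (x ∷ xs) ys {μ} out refl i = trans
  (writes-after b xs (ys ++ x ∷ []) {μ [ b + length ys ≔ x ]}
    (λ j → trans (≔-shift b μ (cell ys) out refl j) (cell-snoc ys x j))
    (sym (trans (cong (b +_) (trans (length-++ ys) (+-comm _ 1))) (+-suc b _))) i)
  (cong (λ zs → cell zs i) (++-assoc ys (x ∷ []) xs))

writes-before : ∀ xs {μ p a} → a < p → writes μ p xs a ≡ μ a
writes-before []       a<p = refl
writes-before (x ∷ xs) {μ} {p} {a} a<p = trans (writes-before xs (m<n⇒m<1+n a<p)) (untouched (<⇒≢ a<p))
  where
  untouched : a ≢ p → (μ [ p ≔ x ]) a ≡ μ a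
  untouched a≢p with a ≡ᵇ p in eq
  ... | true  = contradiction (≡ᵇ⇒≡ a p (subst T (sym eq) tt)) a≢p
  ... | false = refl

drop-∷ : ∀ {A : Set} k (xs : List A) {y ys} → drop k xs ≡ y ∷ ys →
         xs ‼ k ≡ just y × drop (suc k) xs ≡ ys × k < length xs
drop-∷ zero    (x ∷ xs) refl = refl , refl , z<s
drop-∷ (suc k) (x ∷ xs) eq   = let p , q , r = drop-∷ k xs eq in p , q , s<s r
drop-∷ zero    []       ()
drop-∷ (suc k) []       ()

-- A Hoare triple for total correctness with a time bound, with the precondition replaced by a fixed
-- initial store.
record Triple (c : Cmd) (σ : Store) (t : ℕ) (Post : Store → Set) : Set where
  constructor triple
  field
    cost≤ : cost c σ ≤ t
    post  : Post (exec c σ)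
open Triple

seq : ∀ {c c′ σ t t′} {Mid Post : Store → Set} → Triple c σ t Mid → (∀ τ → Mid τ → Triple c′ τ t′ Post) →
      Triple (c ⨾ c′) σ (t + t′) Post
seq T next .cost≤ = +-mono-≤ (cost≤ T) (cost≤ (next _ (post T)))
seq T next .post  = post (next _ (post T))

weaken : ∀ {c σ t t′} {Post Post′ : Store → Set} → t ≤ t′ → (∀ τ → Post τ → Post′ τ) → Triple c σ t Post → Triple c σ t′ Post′
weaken t≤t′ f T .cost≤ = ≤-trans (cost≤ T) t≤t′
weaken t≤t′ f T .post  = f _ (post T)

-- Indexed by the number of rounds left instead of the counter's value, so that loop invariants need
-- not mention the counter and proofs go by induction on `m`.
record Loop (r : Reg) (c : Cmd) (m : ℕ) (σ : Store) (t : ℕ) (Post : Store → Set) : Set where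
  constructor loop
  field
    loopCost≤ : repeatCost m (λ τ → decr r (exec c τ)) (cost c) σ ≤ t
    loopPost  : Post (repeat m (λ τ → decr r (exec c τ)) σ)
open Loop

for-rule : ∀ {r c m σ t Post} → proj₁ σ r ≡ m → Loop r c m σ t Post → Triple (for r c) σ t Post
for-rule refl L = triple (loopCost≤ L) (loopPost L)

loop-zero : ∀ {r c σ Post} → Post σ → Loop r c 0 σ 1 Post
loop-zero p = loop ≤-refl p

loop-suc : ∀ {r c m σ t} {Mid Post : Store → Set} → Triple c σ t (λ τ → Mid (decr r τ)) →
           (∀ τ → Mid τ → Loop r c m τ (m * (4 + t) + 1) Post) →
           Loop r c (suc m) σ (suc m * (4 + t) + 1) Post
loop-suc {r} {c} {m} {σ} {t} T next = loop (begin
  suc (cost c σ + (3 + rest))             ≤⟨ s≤s (+-mono-≤ (cost≤ T) (+-monoʳ-≤ 3 (loopCost≤ L))) ⟩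
  suc (t + (3 + (m * (4 + t) + 1)))       ≡⟨ cong suc (+-assoc t 3 _) ⟨
  suc (t + 3 + (m * (4 + t) + 1))         ≡⟨ cong (λ u → suc (u + (m * (4 + t) + 1))) (+-comm t 3) ⟩
  (4 + t) + (m * (4 + t) + 1)             ≡⟨ +-assoc (4 + t) _ 1 ⟨
  suc m * (4 + t) + 1                     ∎) (loopPost L)
  where
  open ≤-Reasoning
  L = next _ (post T)
  rest = repeatCost m (λ τ → decr r (exec c τ)) (cost c) (decr r (exec c σ))

loop-weaken : ∀ {r c m σ t} {Post Post′ : Store → Set} → (∀ τ → Post τ → Post′ τ) → Loop r c m σ t Post → Loop r c m σ t Post′
loop-weaken f L = loop (loopCost≤ L) (f _ (loopPost L))

-- Copies by subtracting 0, since addition is not among the tame instructions.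
mov : Reg → Reg → Cmd
mov r x = instr (const 15 0) ⨾ instr (op sub r x 15)

-- Register 3 points to the next free cell of the output.
emit : Reg → Cmd
emit r = instr (store 3 r) ⨾ inc 3

-- Register 4 points into the input, 9 holds the bit and 13 its complement; 5, 7 and 8 hold the
-- numbers of leaf, vector and coordinate. Commands have no conditional, so both endpoints of the
-- bit's second edge are selected by arithmetic.
bitBody : Cmd
bitBody =
  instr (load 9 4) ⨾ inc 4 ⨾
  instr (const 12 0) ⨾ emit 12 ⨾ emit 5 ⨾
  instr (const 12 1) ⨾ instr (op sub 13 12 9) ⨾
  instr (op sub 14 8 12) ⨾ instr (op quot 14 14 13) ⨾ instr (op sub 14 8 14) ⨾ emit 14 ⨾
  instr (op sub 14 5 7) ⨾ instr (op quot 14 14 9) ⨾ instr (op sub 14 5 14) ⨾ emit 14 ⨾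
  inc 5 ⨾ inc 8

-- Since x quot 0 = 0 and x quot 1 = x, quot multiplies by a bit.
selectCoord : ∀ b c → suc c ∸ ⟦ quot ⟧ c (1 ∸ toBit b) ≡ (if b then suc c else 1)
selectCoord true  c = refl
selectCoord false c = trans (cong (suc c ∸_) (n/1≡n c)) (m+n∸n≡m 1 c)

selectVertex : ∀ b {v l} → v ≤ l → l ∸ ⟦ quot ⟧ (l ∸ v) (toBit b) ≡ (if b then v else l)
selectVertex true  {v} {l} v≤l = trans (cong (l ∸_) (n/1≡n (l ∸ v))) (m∸[m∸n]≡n v≤l)
selectVertex false v≤l = refl

-- The literals 0 and 1 are the numbers of `apex` and `hub`.
bitCells : ∀ {k} (v c l : ℕ) → Vec Bool k → List ℕ
bitCells v c l []       = []
bitCells v c l (b ∷ bs) =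
  0 ∷ l ∷ (if b then c else 1) ∷ (if b then v else l) ∷ bitCells v (suc c) (suc l) bs

vecHead : Cmd
vecHead =
  mov 7 5 ⨾ inc 5 ⨾ emit 6 ⨾ emit 7 ⨾ emit 7 ⨾ emit 5 ⨾ inc 5 ⨾
  -- The first coordinate that belongs to a bit is `coord (suc zero)`, with number 3.
  instr (const 8 3) ⨾ mov 11 1

vecBody : Cmd
vecBody = vecHead ⨾ for 11 bitBody

vecCells : ∀ {k d} (s v : ℕ) → Vec (Vec Bool d) k → List ℕ
vecCells s v [] = []
vecCells {d = d} s v (a ∷ as) = s ∷ v ∷ v ∷ suc v ∷ bitCells v 3 (2 + v) a ++ vecCells s (d + (2 + v)) as

sideBody : Cmd
sideBody = mov 10 0 ⨾ for 10 vecBody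

starCells : (c k : ℕ) → List ℕ
starCells c zero    = []
starCells c (suc k) = 1 ∷ c ∷ starCells (suc c) k

prologue baseBody hubHead starBody header build : Cmd
prologue =
  instr (const 4 0) ⨾ instr (load 0 4) ⨾ inc 4 ⨾ instr (load 1 4) ⨾ inc 4 ⨾ mov 2 4 ⨾ mov 10 0
-- The end of the input, `2 + n * (d * 2)`, is found by counting, because multiplication is not
-- tame; the time stays proportional to the input.
baseBody = mov 11 1 ⨾ for 11 (inc 2 ⨾ inc 2)
hubHead =
  -- Two cells are skipped for the order and the size, which are known only at the end.
  mov 3 2 ⨾ inc 3 ⨾ inc 3 ⨾ instr (const 9 0) ⨾ emit 9 ⨾ inc 9 ⨾ emit 9 ⨾
  instr (const 5 2) ⨾ mov 11 1 ⨾ inc 11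
starBody = emit 9 ⨾ emit 5 ⨾ inc 5
header =
  -- Two cells per edge and two for the header lie between base and pointer, so the size is half of
  -- this distance minus 1. The next free vertex number, in register 5, is the order.
  instr (op sub 9 3 2) ⨾ instr (const 12 2) ⨾ instr (op quot 9 9 12) ⨾
  instr (const 12 1) ⨾ instr (op sub 9 9 12) ⨾
  instr (store 2 5) ⨾ mov 12 2 ⨾ inc 12 ⨾ instr (store 12 9)
build =
  prologue ⨾ for 10 baseBody ⨾ hubHead ⨾ for 11 starBody ⨾
  -- Register 6 holds the number of the anchor: 0 for `apex`, 2 for `coord zero`.
  instr (const 6 0) ⨾ sideBody ⨾ instr (const 6 2) ⨾ sideBody ⨾ header

graphCells : ∀ {n d} → Vec (Vec Bool d) n → Vec (Vec Bool d) n → List ℕ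
graphCells {n} {d} A B = 0 ∷ 1 ∷ starCells 2 (suc d) ++
  vecCells 0 (3 + d) A ++ vecCells 2 (n * (2 + d) + (3 + d)) B

bits : ∀ {d} → Vec Bool d → List ℕ
bits a = List.map toBit (toList a)

cell-beyond : ∀ xs {i} → length xs ≤ i → cell xs i ≡ 0
cell-beyond []       {i}     _         = cell-[] i
cell-beyond (x ∷ xs) {suc i} (s≤s len) = cell-beyond xs len

-- Correctness of the program that writes the graph

module Building (n d b : ℕ) (input : List ℕ) (length≤b : length input ≤ b) where

  -- `guest` and `output` prepare the guest's initial configuration: `output` describes all cells
  -- from `b` on and thus also says that those behind the list are 0.
  record Inv (out rest : List ℕ) (next : ℕ) (σ : Store) : Set where
    field
      reg0 : proj₁ σ 0 ≡ n
      reg1 : proj₁ σ 1 ≡ d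
      reg2 : proj₁ σ 2 ≡ b
      reg3 : proj₁ σ 3 ≡ b + length out
      reg4 : drop (proj₁ σ 4) input ≡ rest
      reg5 : proj₁ σ 5 ≡ next
      guest  : ∀ r → proj₁ σ (16 + r) ≡ 0
      unread : ∀ a → a < b → proj₂ σ a ≡ cell input a
      output : ∀ i → proj₂ σ (b + i) ≡ cell out i

  module Written {out rest next ρ μ} (I : Inv out rest next (ρ , μ)) (xs : List ℕ) where
    open Inv I

    writes-output : ∀ i → writes μ (ρ 3) xs (b + i) ≡ cell (out ++ xs) i
    writes-output = writes-after b xs out output reg3

    writes-unread : ∀ a → a < b → writes μ (ρ 3) xs a ≡ cell input a
    writes-unread a a<b = trans
      (writes-before xs (<-≤-trans a<b (≤-trans (m≤m+n b _) (≤-reflexive (sym reg3))))) (unread a a<b)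

    advance : ∀ {p} → p ≡ length xs + ρ 3 → p ≡ b + length (out ++ xs)
    advance p≡ = trans p≡ (trans (cong (length xs +_) reg3) (trans (+-comm (length xs) _)
      (trans (+-assoc b _ _) (cong (b +_) (sym (length-++ out))))))

  record BitInv (s v c : ℕ) (out rest : List ℕ) (next : ℕ) (σ : Store) : Set where
    field
      inv  : Inv out rest next σ
      reg6 : proj₁ σ 6 ≡ s
      reg7 : proj₁ σ 7 ≡ v
      reg8 : proj₁ σ 8 ≡ c

  -- The arithmetic selection subtracts the vector's number from the leaf's and 1 from the
  -- coordinate's; `v ≤ l` and the form `suc c` keep these truncated subtractions exact.
  bitBody-correct : ∀ {s v c out rest l} b₀ σ → v ≤ l → BitInv s v (suc c) out (toBit b₀ ∷ rest) l σ →
    Triple bitBody σ 40 (λ τ → BitInv s v (2 + c)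
      (out ++ 0 ∷ l ∷ (if b₀ then suc c else 1) ∷ (if b₀ then v else l) ∷ []) rest (suc l) (decr 11 τ))
  bitBody-correct {s} {v} {c} {out} {rest} {l} b₀ (ρ , μ) v≤l J = triple (≤ᵇ⇒≤ _ _ tt) record
    { inv = record
      { reg0 = reg0 ; reg1 = reg1 ; reg2 = reg2
      ; reg3 = trans (advance refl) (cong (λ xs → b + length (out ++ xs)) written≡)
      ; reg4 = proj₁ (proj₂ (drop-∷ (ρ 4) input reg4))
      ; reg5 = cong suc reg5
      ; guest = guest
      ; unread = writes-unread
      ; output = λ i → trans (writes-output i) (cong (λ xs → cell (out ++ xs) i) written≡)
      }
    ; reg6 = reg6 ; reg7 = reg7 ; reg8 = cong suc reg8
    }
    where
    open BitInv J
    open Inv inv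
    written : List ℕ
    written = 0 ∷ ρ 5 ∷ ρ 8 ∸ ⟦ quot ⟧ (ρ 8 ∸ 1) (1 ∸ μ (ρ 4)) ∷ ρ 5 ∸ ⟦ quot ⟧ (ρ 5 ∸ ρ 7) (μ (ρ 4)) ∷ []
    open Written inv written
    read : μ (ρ 4) ≡ toBit b₀
    read = let p , _ , q = drop-∷ (ρ 4) input reg4 in
      trans (unread (ρ 4) (<-≤-trans q length≤b)) (cong (fromMaybe 0) p)
    written≡ : written ≡ 0 ∷ l ∷ (if b₀ then suc c else 1) ∷ (if b₀ then v else l) ∷ []
    written≡ rewrite read | reg5 | reg7 | reg8 =
      cong₂ (λ x y → 0 ∷ l ∷ x ∷ y ∷ []) (selectCoord b₀ c) (selectVertex b₀ v≤l)

  SideInv : (s : ℕ) (out rest : List ℕ) (next : ℕ) → Store → Set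
  SideInv s out rest next σ = Inv out rest next σ × proj₁ σ 6 ≡ s

  bitLoop : ∀ {k s v c rest} (bs : Vec Bool k) out l σ → v ≤ l →
    BitInv s v (suc c) out (bits bs ++ rest) l σ →
    Loop 11 bitBody k σ (k * 44 + 1) (SideInv s (out ++ bitCells v (suc c) l bs) rest (k + l))
  bitLoop [] out l σ v≤l J = loop-zero
    (subst (λ xs → Inv xs _ _ σ) (sym (++-identityʳ out)) (BitInv.inv J) , BitInv.reg6 J)
  bitLoop {suc k} {s} {v} {c} {rest} (b₀ ∷ bs) out l σ v≤l J =
    loop-suc {Mid = BitInv s v (2 + c) (out ++ first) (bits bs ++ rest) (suc l)} (bitBody-correct b₀ σ v≤l J) λ τ J′ →
      loop-weaken (λ ω (I , r6) → subst₂ (λ xs m → Inv xs rest m ω) (++-assoc out first _) (+-suc k l) I , r6)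
        (bitLoop bs (out ++ first) (suc l) τ (m≤n⇒m≤1+n v≤l) J′)
    where
    first : List ℕ
    first = 0 ∷ l ∷ (if b₀ then suc c else 1) ∷ (if b₀ then v else l) ∷ []

  vecHead-correct : ∀ {s out rest v} σ → SideInv s out rest v σ →
    Triple vecHead σ 40 (λ τ →
      BitInv s v 3 (out ++ s ∷ v ∷ v ∷ suc v ∷ []) rest (2 + v) τ × proj₁ τ 11 ≡ d)
  vecHead-correct {s} {out} {rest} {v} (ρ , μ) (I , r6) = triple (≤ᵇ⇒≤ _ _ tt) (record
    { inv = record
      { reg0 = reg0 ; reg1 = reg1 ; reg2 = reg2
      ; reg3 = trans (advance refl) (cong (λ xs → b + length (out ++ xs)) written≡)
      ; reg4 = reg4
      ; reg5 = cong (2 +_) reg5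
      ; guest = guest
      ; unread = writes-unread
      ; output = λ i → trans (writes-output i) (cong (λ xs → cell (out ++ xs) i) written≡)
      }
    ; reg6 = r6 ; reg7 = reg5 ; reg8 = refl
    } , reg1)
    where
    open Inv I
    written : List ℕ
    written = ρ 6 ∷ ρ 5 ∷ ρ 5 ∷ suc (ρ 5) ∷ []
    open Written I written
    written≡ : written ≡ s ∷ v ∷ v ∷ suc v ∷ []
    written≡ rewrite reg5 | r6 = refl

  -- The decrement writes registers 10 and 15, which no field mentions, so every field carries over
  -- by computation.
  Inv-decr10 : ∀ {out rest next σ} → Inv out rest next σ → Inv out rest next (decr 10 σ)
  Inv-decr10 I = record { Inv I }

  vecBody-correct : ∀ {s out rest v} (a : Vec Bool d) σ → SideInv s out (bits a ++ rest) v σ →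
    Triple vecBody σ (41 + d * 44) (λ τ → SideInv s
      (out ++ s ∷ v ∷ v ∷ suc v ∷ bitCells v 3 (2 + v) a) rest (d + (2 + v)) (decr 10 τ))
  vecBody-correct {s} {out} {rest} {v} a σ I = weaken (≤-reflexive (cong (40 +_) (+-comm (d * 44) 1)))
    (λ τ (J , r6) → Inv-decr10 (subst (λ xs → Inv xs _ _ τ) (++-assoc out (s ∷ v ∷ v ∷ suc v ∷ []) (bitCells v 3 (2 + v) a)) J) , r6)
    (seq (vecHead-correct σ I) λ τ (J , r11) → for-rule r11
      (bitLoop {rest = rest} a (out ++ s ∷ v ∷ v ∷ suc v ∷ []) (2 + v) τ (m≤n+m v 2) J))

  vecLoop : ∀ {k s rest} (as : Vec (Vec Bool d) k) out v σ →
    SideInv s out (encodeVectors as ++ rest) v σ →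
    Loop 10 vecBody k σ (k * (45 + d * 44) + 1) (Inv (out ++ vecCells s v as) rest (k * (2 + d) + v))
  vecLoop [] out v σ (I , _) = loop-zero (subst (λ xs → Inv xs _ _ σ) (sym (++-identityʳ out)) I)
  vecLoop {suc k} {s} {rest} (a ∷ as) out v σ (I , r6) =
    loop-suc {Mid = SideInv s (out ++ first) (encodeVectors as ++ rest) (d + (2 + v))}
      (vecBody-correct a σ (subst (λ xs → Inv out xs v σ) (++-assoc (bits a) (encodeVectors as) rest) I , r6))
      λ τ J → loop-weaken
        (λ ω → subst₂ (λ xs m → Inv xs rest m ω) (++-assoc out first _) (next≡ (k * (2 + d))))
        (vecLoop as (out ++ first) (d + (2 + v)) τ J)
    where
    first : List ℕ
    first = s ∷ v ∷ v ∷ suc v ∷ bitCells v 3 (2 + v) a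
    next≡ : ∀ m → m + (d + (2 + v)) ≡ 2 + d + m + v
    next≡ m = begin
      m + (d + (2 + v)) ≡⟨ cong (m +_) (+-assoc d 2 v) ⟨
      m + (d + 2 + v)   ≡⟨ +-assoc m (d + 2) v ⟨
      m + (d + 2) + v   ≡⟨ cong (_+ v) (trans (+-comm m _) (cong (_+ m) (+-comm d 2))) ⟩
      2 + d + m + v     ∎
      where open ≡-Reasoning

  sideBody-correct : ∀ {s out rest v} (as : Vec (Vec Bool d) n) σ →
    SideInv s out (encodeVectors as ++ rest) v σ →
    Triple sideBody σ (3 + n * (45 + d * 44)) (Inv (out ++ vecCells s v as) rest (n * (2 + d) + v))
  sideBody-correct {s} {out} {rest} {v} as σ (I , r6) =
    weaken (≤-reflexive (cong (2 +_) (+-comm (n * (45 + d * 44)) 1))) (λ τ J → J)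
      (seq {Mid = λ τ → SideInv s out (encodeVectors as ++ rest) v τ × proj₁ τ 10 ≡ n}
        (triple ≤-refl ((record { Inv I } , r6) , Inv.reg0 I))
        λ τ (J , r10) → for-rule r10 (vecLoop as out v τ J))

  record Start (base : ℕ) (σ : Store) : Set where
    field
      reg0 : proj₁ σ 0 ≡ n
      reg1 : proj₁ σ 1 ≡ d
      reg2 : proj₁ σ 2 ≡ base
      reg4 : proj₁ σ 4 ≡ 2
      guest  : ∀ r → proj₁ σ (16 + r) ≡ 0
      unread : ∀ a → proj₂ σ a ≡ cell input a

  prologue-correct : ∀ σ → cell input 0 ≡ n → cell input 1 ≡ d →
    (∀ r → proj₁ σ r ≡ 0) → (∀ a → proj₂ σ a ≡ cell input a) →
    Triple prologue σ 20 (λ τ → Start 2 τ × proj₁ τ 10 ≡ n)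
  prologue-correct (ρ , μ) n≡ d≡ ρ≡0 μ≡ = triple (≤ᵇ⇒≤ _ _ tt) (record
    { reg0 = trans (μ≡ 0) n≡ ; reg1 = trans (μ≡ 1) d≡ ; reg2 = refl ; reg4 = refl
    ; guest = λ r → ρ≡0 (16 + r) ; unread = μ≡
    } , trans (μ≡ 0) n≡)

  baseLoop : ∀ k {p} σ → Start p σ → Loop 11 (inc 2 ⨾ inc 2) k σ (k * 8 + 1) (Start (k * 2 + p))
  baseLoop zero    σ S = loop-zero S
  baseLoop (suc k) {p} σ S = loop-suc {Mid = Start (2 + p)}
    (triple ≤-refl (record { Start S ; reg2 = cong (2 +_) (Start.reg2 S) }))
    λ τ S′ → loop-weaken (λ ω → subst (λ q → Start q ω) (trans (+-suc (k * 2) (suc p)) (cong suc (+-suc (k * 2) p))))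
      (baseLoop k τ S′)

  baseLoops : ∀ m {p} σ → Start p σ → Loop 10 baseBody m σ (m * (7 + d * 8) + 1) (Start (m * (d * 2) + p))
  baseLoops zero    σ S = loop-zero S
  baseLoops (suc m) {p} σ S = loop-suc {Mid = Start (d * 2 + p)}
    (weaken (≤-reflexive (cong (2 +_) (+-comm (d * 8) 1))) (λ τ S′ → record { Start S′ })
      (seq {Mid = λ τ → Start p τ × proj₁ τ 11 ≡ d} (triple ≤-refl (record { Start S } , Start.reg1 S))
        λ τ (S′ , r11) → for-rule r11 (baseLoop d τ S′)))
    λ τ S′ → loop-weaken (λ ω → subst (λ q → Start q ω)
      (trans (sym (+-assoc (m * (d * 2)) (d * 2) p)) (cong (_+ p) (+-comm (m * (d * 2)) (d * 2)))))
      (baseLoops m τ S′)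

  hubHead-correct : ∀ {rest} σ → drop 2 input ≡ rest → Start b σ →
    Triple hubHead σ 40 (λ τ → (Inv (0 ∷ 0 ∷ 0 ∷ 1 ∷ []) rest 2 τ × proj₁ τ 9 ≡ 1) × proj₁ τ 11 ≡ suc d)
  hubHead-correct (ρ , μ) rest≡ S = triple (≤ᵇ⇒≤ _ _ tt) ((record
    { reg0 = reg0 ; reg1 = reg1 ; reg2 = reg2
    ; reg3 = trans (cong (4 +_) reg2) (+-comm 4 b)
    ; reg4 = trans (cong (λ k → drop k input) reg4) rest≡
    ; reg5 = refl
    ; guest = guest
    ; unread = λ a a<b → trans (writes-before (0 ∷ 1 ∷ []) {μ} {2 + ρ 2} (<-≤-trans a<b
        (≤-trans (≤-reflexive (sym reg2)) (m≤n+m (ρ 2) 2)))) (unread a)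
    ; output = writes-after b (0 ∷ 1 ∷ []) (0 ∷ 0 ∷ []) {μ} blank (trans (cong (2 +_) reg2) (+-comm 2 b))
    } , refl) , cong suc reg1)
    where
    open Start S
    -- The skipped header cells lie behind the input and still hold 0, so they count as written
    -- zeros.
    blank : ∀ i → μ (b + i) ≡ cell (0 ∷ 0 ∷ []) i
    blank i = trans (unread (b + i)) (trans (cell-beyond input (≤-trans length≤b (m≤m+n b i))) (sym (zeros i)))
      where
      zeros : ∀ i → cell (0 ∷ 0 ∷ []) i ≡ 0
      zeros zero          = refl
      zeros (suc zero)    = refl
      zeros (suc (suc i)) = cell-[] i

  starBody-correct : ∀ {out rest c} σ → Inv out rest c σ × proj₁ σ 9 ≡ 1 →
    Triple starBody σ 10 (λ τ → Inv (out ++ 1 ∷ c ∷ []) rest (suc c) (decr 11 τ) × proj₁ (decr 11 τ) 9 ≡ 1)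
  starBody-correct {out} {rest} {c} (ρ , μ) (I , r9) = triple (≤ᵇ⇒≤ _ _ tt) (record
    { reg0 = reg0 ; reg1 = reg1 ; reg2 = reg2
    ; reg3 = trans (advance refl) (cong (λ xs → b + length (out ++ xs)) written≡)
    ; reg4 = reg4
    ; reg5 = cong suc reg5
    ; guest = guest
    ; unread = writes-unread
    ; output = λ i → trans (writes-output i) (cong (λ xs → cell (out ++ xs) i) written≡)
    } , r9)
    where
    open Inv I
    written : List ℕ
    written = ρ 9 ∷ ρ 5 ∷ []
    open Written I written
    written≡ : written ≡ 1 ∷ c ∷ []
    written≡ = cong₂ (λ x y → x ∷ y ∷ []) r9 reg5

  starLoop : ∀ k {out rest c} σ → Inv out rest c σ × proj₁ σ 9 ≡ 1 →
    Loop 11 starBody k σ (k * 14 + 1) (Inv (out ++ starCells c k) rest (k + c))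
  starLoop zero    {out} σ (I , _) = loop-zero (subst (λ xs → Inv xs _ _ σ) (sym (++-identityʳ out)) I)
  starLoop (suc k) {out} {rest} {c} σ I =
    loop-suc {Mid = λ τ → Inv (out ++ 1 ∷ c ∷ []) rest (suc c) τ × proj₁ τ 9 ≡ 1} (starBody-correct σ I)
      λ τ J → loop-weaken (λ ω → subst₂ (λ xs m → Inv xs rest m ω) (++-assoc out (1 ∷ c ∷ []) _) (+-suc k c))
        (starLoop k τ J)

  record Built (cells : List ℕ) (σ : Store) : Set where
    field
      reg0 : proj₁ σ 0 ≡ n
      reg1 : proj₁ σ 1 ≡ d
      reg2 : proj₁ σ 2 ≡ b
      guest  : ∀ r → proj₁ σ (16 + r) ≡ 0
      output : ∀ i → proj₂ σ (b + i) ≡ cell cells i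

  header-correct : ∀ {ys next} m σ → length ys ≡ m * 2 → Inv (0 ∷ 0 ∷ ys) [] next σ →
    Triple header σ 20 (Built (next ∷ m ∷ ys))
  header-correct {ys} {next} m (ρ , μ) len I = triple (≤ᵇ⇒≤ _ _ tt) record
    { reg0 = reg0 ; reg1 = reg1 ; reg2 = reg2 ; guest = guest
    ; output = stored reg5 count
        (trans reg2 (sym (+-identityʳ b))) (trans (cong suc reg2) (+-comm 1 b))
    }
    where
    open Inv I
    count : (ρ 3 ∸ ρ 2) / 2 ∸ 1 ≡ m
    count rewrite reg3 | reg2 | m+n∸m≡n b (suc (suc (length ys))) | len = cong (_∸ 1) (m*n/n≡m (suc m) 2)
    stored : ∀ {p q u v} → u ≡ next → v ≡ m → p ≡ b + 0 → q ≡ b + 1 →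
             ∀ i → (μ [ p ≔ u ] [ q ≔ v ]) (b + i) ≡ cell (next ∷ m ∷ ys) i
    stored {u = u} {v} refl refl refl refl i = trans
      (≔-shift b (μ [ b + 0 ≔ u ]) (cell (0 ∷ 0 ∷ ys) [ 0 ≔ u ])
        (≔-shift b μ (cell (0 ∷ 0 ∷ ys)) output refl) refl i)
      (overwritten i)
      where
      overwritten : ∀ i → (cell (0 ∷ 0 ∷ ys) [ 0 ≔ u ] [ 1 ≔ v ]) i ≡ cell (u ∷ v ∷ ys) i
      overwritten zero          = refl
      overwritten (suc zero)    = refl
      overwritten (suc (suc i)) = refl

buildTime : ℕ → ℕ → ℕ
buildTime n d = 20 + ((n * (7 + d * 8) + 1) + (40 + ((suc d * 14 + 1) +
  (1 + ((3 + n * (45 + d * 44)) + (1 + ((3 + n * (45 + d * 44)) + 20)))))))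

module _ {n d : ℕ} (A B : Vec (Vec Bool d) n) where

  guestBase : ℕ
  guestBase = n * (d * 2) + 2

  length-bits : ∀ {k} (a : Vec Bool k) → length (bits a) ≡ k
  length-bits []      = refl
  length-bits (x ∷ a) = cong suc (length-bits a)

  length-encodeVectors : ∀ {k} (as : Vec (Vec Bool d) k) → length (encodeVectors as) ≡ k * d
  length-encodeVectors []       = refl
  length-encodeVectors (a ∷ as) = trans (length-++ (bits a)) (cong₂ _+_ (length-bits a) (length-encodeVectors as))

  length-encodeOV : length (encodeOV A B) ≡ guestBase
  length-encodeOV = begin
    2 + length (encodeVectors A ++ encodeVectors B)        ≡⟨ cong (2 +_) (length-++ (encodeVectors A)) ⟩
    2 + (length (encodeVectors A) + length (encodeVectors B)) ≡⟨ cong₂ (λ x y → 2 + (x + y)) (length-encodeVectors A) (length-encodeVectors B) ⟩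
    2 + (n * d + n * d)     ≡⟨ cong (2 +_) (*-distribˡ-+ n d d) ⟨
    2 + n * (d + d)         ≡⟨ cong (λ m → 2 + n * m) (trans (cong (d +_) (sym (+-identityʳ d))) (*-comm 2 d)) ⟩
    2 + n * (d * 2)         ≡⟨ +-comm 2 _ ⟩
    n * (d * 2) + 2         ∎
    where open ≡-Reasoning

  open Building n d guestBase (encodeOV A B) (≤-reflexive length-encodeOV)

  build-correct : ∀ m σ → length (graphCells A B) ≡ m * 2 →
    (∀ r → proj₁ σ r ≡ 0) → (∀ a → proj₂ σ a ≡ cell (encodeOV A B) a) →
    Triple build σ (buildTime n d) (Built (n * (2 + d) + (n * (2 + d) + (3 + d)) ∷ m ∷ graphCells A B))
  build-correct m σ len ρ≡0 μ≡ =
    seq (prologue-correct σ refl refl ρ≡0 μ≡) λ τ (S , r10) →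
    seq (for-rule r10 (baseLoops n τ S)) λ τ S →
    seq (hubHead-correct τ refl S) λ τ (I , r11) →
    seq (for-rule r11 (starLoop (suc d) τ I)) λ τ I →
    seq {Mid = SideInv 0 star (encodeVectors A ++ encodeVectors B) (3 + d)} (triple ≤-refl
      (record { Inv (subst (λ k → Inv star (encodeVectors A ++ encodeVectors B) k τ) (+-comm (suc d) 2) I) } , refl)) λ τ I →
    seq (sideBody-correct A τ I) λ τ I →
    seq {Mid = SideInv 2 (star ++ vecCells 0 (3 + d) A) (encodeVectors B ++ []) (n * (2 + d) + (3 + d))} (triple ≤-refl
      (record { Inv (subst (λ xs → Inv (star ++ vecCells 0 (3 + d) A) xs (n * (2 + d) + (3 + d)) τ) (sym (++-identityʳ (encodeVectors B))) I) } , refl)) λ τ I →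
    seq (sideBody-correct B τ I) λ τ I →
    header-correct m τ len (subst (λ xs → Inv xs [] (n * (2 + d) + (n * (2 + d) + (3 + d))) τ) (++-assoc star (vecCells 0 (3 + d) A) _) I)
    where
    star : List ℕ
    star = 0 ∷ 0 ∷ 0 ∷ 1 ∷ starCells 2 (suc d)

-- The first vector of A has number `3 + d`, and successive ones are `2 + d` apart, as each is
-- followed by its pendant and its leaves. Register 9 loses the excess over 4 of every estimate
-- read.
estimateBody readout : Cmd
estimateBody =
  (instr (load 12 3) ⨾ instr (const 13 4) ⨾ instr (op sub 12 12 13) ⨾ instr (op sub 9 9 12) ⨾
   inc 3 ⨾ inc 3 ⨾ mov 11 1) ⨾ for 11 (inc 3)
readout =
  (mov 3 2 ⨾ inc 3 ⨾ inc 3 ⨾ inc 3 ⨾ mov 11 1) ⨾ for 11 (inc 3) ⨾ (instr (const 9 1) ⨾ mov 10 0) ⨾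
  for 10 estimateBody ⨾
  (instr (const 12 1) ⨾ instr (op sub 9 12 9) ⨾ instr (const 12 0) ⨾ instr (store 12 9))

-- Starting from 1, this ends at 0 exactly when some e i exceeds 4.
drain : ℕ → (ℕ → ℕ) → ℕ → ℕ
drain zero    e x = x
drain (suc m) e x = drain m (e ∘ suc) (x ∸ (e 0 ∸ 4))

drain-0 : ∀ m e → drain m e 0 ≡ 0
drain-0 zero    e = refl
drain-0 (suc m) e rewrite 0∸n≡0 (e 0 ∸ 4) = drain-0 m (e ∘ suc)

drain-small : ∀ m e x → (∀ (i : Fin m) → e (toℕ i) ≤ 4) → drain m e x ≡ x
drain-small zero    e x e≤4 = refl
drain-small (suc m) e x e≤4 rewrite m≤n⇒m∸n≡0 (e≤4 zero) = drain-small m (e ∘ suc) x (e≤4 ∘ suc)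

drain-large : ∀ m e x (i : Fin m) → x ≤ 1 → 5 ≤ e (toℕ i) → drain m e x ≡ 0
drain-large (suc m) e x zero    x≤1 5≤e
  rewrite m≤n⇒m∸n≡0 (≤-trans x≤1 (∸-monoˡ-≤ 4 5≤e)) = drain-0 m (e ∘ suc)
drain-large (suc m) e x (suc i) x≤1 5≤e =
  drain-large m (e ∘ suc) _ i (≤-trans (m∸n≤m x (e 0 ∸ 4)) x≤1) 5≤e

readoutTime : ℕ → ℕ → ℕ
readoutTime n d = 20 + ((d * 6 + 1) + (3 + ((n * (25 + d * 6) + 1) + 10)))

-- Correctness of the program that reads the estimates

module Reading (n d : ℕ) (μ₀ : Addr → ℕ) where

  record Scan (p x : ℕ) (σ : Store) : Set where
    field
      reg0 : proj₁ σ 0 ≡ n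
      reg1 : proj₁ σ 1 ≡ d
      reg3 : proj₁ σ 3 ≡ p
      reg9 : proj₁ σ 9 ≡ x
      kept : ∀ a → proj₂ σ a ≡ μ₀ a

  advanceLoop : ∀ k {p x} σ → Scan p x σ → Loop 11 (inc 3) k σ (k * 6 + 1) (Scan (k + p) x)
  advanceLoop zero    σ S = loop-zero S
  advanceLoop (suc k) {p} {x} σ S = loop-suc {Mid = Scan (suc p) x}
    (triple ≤-refl (record { Scan S ; reg3 = cong suc (Scan.reg3 S) }))
    λ τ S′ → loop-weaken (λ ω → subst (λ q → Scan q x ω) (+-suc k p)) (advanceLoop k τ S′)

  estimateBody-correct : ∀ {p x} σ → Scan p x σ →
    Triple estimateBody σ (21 + d * 6) (λ τ → Scan (d + (2 + p)) (x ∸ (μ₀ p ∸ 4)) (decr 10 τ))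
  estimateBody-correct {p} {x} (ρ , μ) S = weaken (≤-reflexive (cong (20 +_) (+-comm (d * 6) 1)))
    (λ τ S′ → record { Scan S′ })
    (seq {t = 20} {Mid = λ τ → Scan (2 + p) (x ∸ (μ₀ p ∸ 4)) τ × proj₁ τ 11 ≡ d}
      (triple (≤ᵇ⇒≤ _ _ tt) (record
        { reg0 = reg0 ; reg1 = reg1 ; reg3 = cong (2 +_) reg3
        ; reg9 = cong₂ (λ x y → x ∸ (y ∸ 4)) reg9 (trans (cong μ reg3) (kept p))
        ; kept = kept
        } , reg1))
      λ τ (S′ , r11) → for-rule r11 (advanceLoop d τ S′))
    where open Scan S

  estimateLoop : ∀ m {p x} σ → Scan p x σ →
    Loop 10 estimateBody m σ (m * (25 + d * 6) + 1) (λ τ → ∃[ q ] Scan q (drain m (λ i → μ₀ (i * (2 + d) + p)) x) τ)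
  estimateLoop zero    σ S = loop-zero (_ , S)
  estimateLoop (suc m) {p} {x} σ S = loop-suc {Mid = Scan (d + (2 + p)) (x ∸ (μ₀ p ∸ 4))}
    (estimateBody-correct σ S)
    λ τ S′ → loop-weaken (λ ω (q , S″) → q , subst (λ y → Scan q y ω) (drain-cong m _ shifted) S″)
      (estimateLoop m τ S′)
    where
    drain-cong : ∀ m {e e′} y → (∀ i → e i ≡ e′ i) → drain m e y ≡ drain m e′ y
    drain-cong zero    y e≗e′ = refl
    drain-cong (suc m) {e} {e′} y e≗e′ =
      trans (cong (λ z → drain m (e ∘ suc) (y ∸ (z ∸ 4))) (e≗e′ 0)) (drain-cong m _ (e≗e′ ∘ suc))
    shifted : ∀ i → μ₀ (i * (2 + d) + (d + (2 + p))) ≡ μ₀ (suc i * (2 + d) + p)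
    shifted i = cong μ₀ (begin
      i * (2 + d) + (d + (2 + p)) ≡⟨ cong (i * (2 + d) +_) (+-assoc d 2 p) ⟨
      i * (2 + d) + (d + 2 + p)   ≡⟨ cong (λ m → i * (2 + d) + (m + p)) (+-comm d 2) ⟩
      i * (2 + d) + (2 + d + p)   ≡⟨ +-assoc (i * (2 + d)) (2 + d) p ⟨
      i * (2 + d) + (2 + d) + p   ≡⟨ cong (_+ p) (+-comm (i * (2 + d)) (2 + d)) ⟩
      suc i * (2 + d) + p         ∎)
      where open ≡-Reasoning

  readout-correct : ∀ {b} σ → proj₁ σ 0 ≡ n → proj₁ σ 1 ≡ d → proj₁ σ 2 ≡ b → (∀ a → proj₂ σ a ≡ μ₀ a) →
    Triple readout σ (readoutTime n d)
      (λ τ → proj₂ τ 0 ≡ 1 ∸ drain n (λ i → μ₀ (i * (2 + d) + (d + (3 + b)))) 1)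
  readout-correct {b} σ r0 r1 r2 kept =
    seq {t = 20} {Mid = λ τ → Scan (3 + b) (proj₁ σ 9) τ × proj₁ τ 11 ≡ d}
      (triple (≤ᵇ⇒≤ _ _ tt) (record { reg0 = r0 ; reg1 = r1 ; reg3 = cong (3 +_) r2 ; reg9 = refl ; kept = kept } , r1))
      λ τ (S , r11) →
    seq (for-rule r11 (advanceLoop d τ S)) λ τ S →
    seq {t = 3} {Mid = λ τ → Scan (d + (3 + b)) 1 τ × proj₁ τ 10 ≡ n}
      (triple ≤-refl (record { Scan S ; reg9 = refl } , Scan.reg0 S)) λ τ (S , r10) →
    seq (for-rule r10 (estimateLoop n τ S)) λ τ (_ , S) →
    triple (≤ᵇ⇒≤ _ _ tt) (cong (1 ∸_) (Scan.reg9 S))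

-- The encoding of the graph

length-⋃ : ∀ {A : Set} {m} (f : Fin m → List A) k → (∀ i → length (f i) ≡ k) → length (⋃ f) ≡ m * k
length-⋃ {m = zero}  f k len = refl
length-⋃ {m = suc m} f k len = trans (length-++ (f zero)) (cong₂ _+_ (len zero) (length-⋃ (f ∘ suc) k (len ∘ suc)))

module Encoding {n d : ℕ} (A B : Vec (Vec Bool d) n) where

  open OVGraph A B

  pairCells : Node n d × Node n d → List ℕ
  pairCells (u , v) = number u ∷ number v ∷ []

  cells : List (Node n d × Node n d) → List ℕ
  cells = concatMap pairCells

  length-cells : ∀ es → length (cells es) ≡ length es * 2
  length-cells []       = refl
  length-cells (e ∷ es) = cong (2 +_) (length-cells es)

  cells-star : ∀ k (f : Fin k → Node n d) c → (∀ j → number (f j) ≡ c + toℕ j) →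
               cells (tabulate λ j → hub , f j) ≡ starCells c k
  cells-star zero    f c f# = refl
  cells-star (suc k) f c f# = cong₂ (λ x xs → 1 ∷ x ∷ xs) (trans (f# zero) (+-identityʳ c))
    (cells-star k (f ∘ suc) (suc c) λ j → trans (f# (suc j)) (+-suc c (toℕ j)))

  -- Stated for arbitrary consecutively numbered families `f` and `g`, because each recursion step
  -- composes the coordinates and the leaves with `suc`.
  cells-bits : ∀ {k} (bs : Vec Bool k) u (f g : Fin k → Node n d) c l →
    (∀ j → number (f j) ≡ c + toℕ j) → (∀ j → number (g j) ≡ l + toℕ j) →
    cells (⋃ λ j → (apex , g j) ∷ (if lookup bs j then (f j , u) else (hub , g j)) ∷ []) ≡
    bitCells (number u) c l bs
  cells-bits [] u f g c l f# g# = refl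
  cells-bits (b ∷ bs) u f g c l f# g# = trans
    (cong₂ (λ x xs → 0 ∷ x ∷ xs) g0 (head≡ b later))
    (cong (λ xs → 0 ∷ l ∷ (if b then c else 1) ∷ (if b then number u else l) ∷ xs)
      (cells-bits bs u (f ∘ suc) (g ∘ suc) (suc c) (suc l)
        (λ j → trans (f# (suc j)) (+-suc c (toℕ j))) (λ j → trans (g# (suc j)) (+-suc l (toℕ j)))))
    where
    later : List (Node n d × Node n d)
    later = ⋃ λ j → (apex , g (suc j)) ∷ (if lookup bs j then (f (suc j) , u) else (hub , g (suc j))) ∷ []
    g0 : number (g zero) ≡ l
    g0 = trans (g# zero) (+-identityʳ l)
    head≡ : ∀ b es → cells ((if b then (f zero , u) else (hub , g zero)) ∷ es) ≡
            (if b then c else 1) ∷ (if b then number u else l) ∷ cells es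
    head≡ true  es = cong (λ x → x ∷ _) (trans (f# zero) (+-identityʳ c))
    head≡ false es = cong (λ x → 1 ∷ x ∷ _) g0

  cells-vecs : ∀ {k} s (as : Vec (Vec Bool d) k) (ι : Fin k → Fin n) v →
    (∀ i o → slotNumber s (ι i) o ≡ v + (toℕ i * (2 + d) + o)) →
    cells (⋃ λ i → (anchor s , vec s (ι i)) ∷ (vec s (ι i) , pend s (ι i)) ∷ ⋃ λ j →
      (apex , leaf s (ι i) j) ∷
      (if lookup (lookup as i) j then (coord (suc j) , vec s (ι i)) else (hub , leaf s (ι i) j)) ∷ []) ≡
    vecCells (number (anchor s)) v as
  cells-vecs s [] ι v ι# = refl
  cells-vecs {suc k} s (a ∷ as) ι v ι# = trans (concatMap-++ pairCells block _)
    (cong₂ _++_ block≡ (cells-vecs s as (ι ∘ suc) (d + (2 + v)) λ i o →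
      trans (ι# (suc i) o) (shift d v (toℕ i * (2 + d)) o)))
    where
    bitPart block : List (Node n d × Node n d)
    bitPart = ⋃ λ j → (apex , leaf s (ι zero) j) ∷
      (if lookup a j then (coord (suc j) , vec s (ι zero)) else (hub , leaf s (ι zero) j)) ∷ []
    block = (anchor s , vec s (ι zero)) ∷ (vec s (ι zero) , pend s (ι zero)) ∷ bitPart
    shift : ∀ d v m o → v + ((2 + d + m) + o) ≡ d + (2 + v) + (m + o)
    shift = solve 4 (λ d v m o → v :+ ((con 2 :+ d :+ m) :+ o) := d :+ (con 2 :+ v) :+ (m :+ o)) refl
      where open +-*-Solver
    vec≡ : number (vec s (ι zero)) ≡ v
    vec≡ = trans (number-vec s _) (trans (ι# zero 0) (+-identityʳ v))
    pend≡ : number (pend s (ι zero)) ≡ suc v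
    pend≡ = trans (number-pend s _) (trans (ι# zero 1) (+-comm v 1))
    leaf≡ : ∀ j → number (leaf s (ι zero) j) ≡ (2 + v) + toℕ j
    leaf≡ j = trans (number-leaf s _ j) (trans (ι# zero (2 + toℕ j))
      (trans (+-suc v _) (cong suc (+-suc v _))))
    block≡ : cells block ≡ number (anchor s) ∷ v ∷ v ∷ suc v ∷ bitCells v 3 (2 + v) a
    block≡ = trans
      (cong₂ (λ x y → number (anchor s) ∷ x ∷ x ∷ y ∷ cells bitPart) vec≡ pend≡)
      (cong (λ xs → number (anchor s) ∷ v ∷ v ∷ suc v ∷ xs)
        (trans (cells-bits a (vec s (ι zero)) (coord ∘ suc) (leaf s (ι zero)) 3 (2 + v) (number-coord ∘ suc) leaf≡)
               (cong (λ x → bitCells x 3 (2 + v) a) vec≡)))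

  cells-nodeEdges : cells nodeEdges ≡ graphCells A B
  cells-nodeEdges = cong (λ xs → 0 ∷ 1 ∷ xs) (trans
    (concatMap-++ pairCells (tabulate hubEdge) _)
    (cong₂ _++_ (cells-star (suc d) coord 2 number-coord) (trans
      (concatMap-++ pairCells (⋃ (vecEdges zero)) (⋃ (vecEdges (suc zero)) ++ []))
      (cong₂ _++_
        (cells-vecs zero A (λ i → i) (3 + d) (λ i o → side₀ (3 + d) (n * (2 + d)) (2 + d) (toℕ i) o))
        (trans (cong cells (++-identityʳ (⋃ (vecEdges (suc zero)))))
          (cells-vecs (suc zero) B (λ i → i) (n * (2 + d) + (3 + d))
            (λ i o → side₁ (3 + d) (n * (2 + d)) (2 + d) (toℕ i) o)))))))
    where
    open +-*-Solver
    side₀ : ∀ h b m i o → h + (b * 0 + (m * i + o)) ≡ h + (i * m + o)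
    side₀ = solve 5 (λ h b m i o → h :+ (b :* con 0 :+ (m :* i :+ o)) := h :+ (i :* m :+ o)) refl
    side₁ : ∀ h b m i o → h + (b * 1 + (m * i + o)) ≡ b + h + (i * m + o)
    side₁ = solve 5 (λ h b m i o → h :+ (b :* con 1 :+ (m :* i :+ o)) := b :+ h :+ (i :* m :+ o)) refl

  encodeGraph≡ : encodeGraph graph ≡ n * (2 + d) + (n * (2 + d) + (3 + d)) ∷ size graph ∷ graphCells A B
  encodeGraph≡ = cong₂ (λ x xs → x ∷ size graph ∷ xs)
    (solve 2 (λ h b → h :+ con 2 :* b := b :+ (b :+ h)) refl (3 + d) (n * (2 + d)))
    (trans (concatMap-map (λ (u , v) → toℕ u ∷ toℕ v ∷ []) (λ (u , v) → index u , index v) nodeEdges) cells-nodeEdges)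
    where open +-*-Solver

  length-graphCells : length (graphCells A B) ≡ size graph * 2
  length-graphCells = trans (cong length (sym cells-nodeEdges))
    (trans (length-cells nodeEdges) (cong (_* 2) (sym (length-map _ nodeEdges))))

  number-A : ∀ i → number (vec zero i) ≡ toℕ i * (2 + d) + (3 + d)
  number-A i = trans (number-vec zero i)
    (solve 4 (λ h b m i → h :+ (b :* con 0 :+ (m :* i :+ con 0)) := i :* m :+ h) refl (3 + d) (n * (2 + d)) (2 + d) (toℕ i))
    where open +-*-Solver

  size-graph : size graph ≡ (2 + d) + 2 * (n * (2 + d * 2))
  size-graph = trans (length-map _ nodeEdges) (trans (length-++ coordEdges) (cong₂ _+_
    (cong suc (length-tabulate hubEdge))
    (length-⋃ (λ s → ⋃ (vecEdges s)) (n * (2 + d * 2)) λ s → length-⋃ (vecEdges s) (2 + d * 2) λ i →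
      cong (2 +_) (length-⋃ (bitEdges s i) 2 λ j → refl))))

  -- Each bit owns one vertex, its leaf, and two edges, which gives the factor 2. The summand
  -- `4 + d + 4 * n` is the difference of the two sides.
  sparse : size graph ≤ 2 * order graph
  sparse = subst₂ _≤_ (sym size-graph) (total n d) (m≤m+n ((2 + d) + 2 * (n * (2 + d * 2))) (4 + d + 4 * n))
    where
    open +-*-Solver
    total : ∀ n d → (2 + d) + 2 * (n * (2 + d * 2)) + (4 + d + 4 * n) ≡ 2 * ((3 + d) + 2 * (n * (2 + d)))
    total = solve 2 (λ n d → (con 2 :+ d) :+ con 2 :* (n :* (con 2 :+ d :* con 2)) :+ (con 4 :+ d :+ con 4 :* n) :=
      con 2 :* ((con 3 :+ d) :+ con 2 :* (n :* (con 2 :+ d)))) refl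

-- Space and time bounds

m<2^m : ∀ m → m < 2 ^ m
m<2^m zero    = z<s
m<2^m (suc m) = begin-strict
  suc m           <⟨ s<s (m<2^m m) ⟩
  suc (2 ^ m)     ≤⟨ +-monoˡ-≤ (2 ^ m) (m^n>0 2 m) ⟩
  2 ^ m + 2 ^ m   ≡⟨ cong (2 ^ m +_) (sym (+-identityʳ _)) ⟩
  2 ^ suc m       ∎
  where open ≤-Reasoning

log-upper : ∀ n → n < 2 ^ (1 + ⌊log₂ n ⌋)
log-upper n = ≰⇒> λ 2^≤n → 1+n≰n (subst (_≤ ⌊log₂ n ⌋) (⌊log₂[2^n]⌋≡n (1 + ⌊log₂ n ⌋)) (⌊log₂⌋-mono-≤ 2^≤n))

log-lower : ∀ n → 1 ≤ n → 2 ^ ⌊log₂ n ⌋ ≤ n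
log-lower = <-rec (λ n → 1 ≤ n → 2 ^ ⌊log₂ n ⌋ ≤ n) go
  where
  go : ∀ n → (∀ {m} → m < n → 1 ≤ m → 2 ^ ⌊log₂ m ⌋ ≤ m) → 1 ≤ n → 2 ^ ⌊log₂ n ⌋ ≤ n
  go 1 ih _ = ≤-refl
  go n@(suc (suc n′)) ih _ = begin
    2 ^ ⌊log₂ n ⌋             ≡⟨ cong (2 ^_) (m+[n∸m]≡n {1} (⌊log₂⌋-mono-≤ {2} {n} (s≤s (s≤s z≤n)))) ⟨
    2 * 2 ^ (⌊log₂ n ⌋ ∸ 1)   ≡⟨ cong (λ l → 2 * 2 ^ l) (⌊log₂⌊n/2⌋⌋≡⌊log₂n⌋∸1 n) ⟨
    2 * 2 ^ ⌊log₂ ⌊ n /2⌋ ⌋   ≤⟨ *-monoʳ-≤ 2 (ih (⌊n/2⌋<n (suc n′)) (s≤s z≤n)) ⟩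
    2 * ⌊ n /2⌋               ≡⟨ cong (⌊ n /2⌋ +_) (+-identityʳ _) ⟩
    ⌊ n /2⌋ + ⌊ n /2⌋         ≤⟨ +-monoʳ-≤ ⌊ n /2⌋ (⌊n/2⌋≤⌈n/2⌉ n) ⟩
    ⌊ n /2⌋ + ⌈ n /2⌉         ≡⟨ ⌊n/2⌋+⌈n/2⌉≡n n ⟩
    n                         ∎
    where open ≤-Reasoning

dimension-bound : ∀ c n → ⌊ c ·log₂ n ⌋ ≤ ∣ ↥ c ∣ * (1 + ⌊log₂ n ⌋)
dimension-bound c n = begin
  ⌊log₂ n ^ p ⌋ / ↧ₙ c                 ≤⟨ m/n≤m _ (↧ₙ c) ⟩
  ⌊log₂ n ^ p ⌋                        ≤⟨ ⌊log₂⌋-mono-≤ (^-monoˡ-≤ p (<⇒≤ (log-upper n))) ⟩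
  ⌊log₂ (2 ^ (1 + ⌊log₂ n ⌋)) ^ p ⌋    ≡⟨ cong ⌊log₂_⌋ (^-*-assoc 2 (1 + ⌊log₂ n ⌋) p) ⟩
  ⌊log₂ 2 ^ ((1 + ⌊log₂ n ⌋) * p) ⌋    ≡⟨ ⌊log₂[2^n]⌋≡n _ ⟩
  (1 + ⌊log₂ n ⌋) * p                  ≡⟨ *-comm _ p ⟩
  p * (1 + ⌊log₂ n ⌋)                  ∎
  where
  open ≤-Reasoning
  p = ∣ ↥ c ∣

^-distrib-* : ∀ k m n → (m * n) ^ k ≡ m ^ k * n ^ k
^-distrib-* zero    m n = refl
^-distrib-* (suc k) m n = trans (cong (m * n *_) (^-distrib-* k m n))
  (solve 4 (λ m n x y → m :* n :* (x :* y) := m :* x :* (n :* y)) refl m n (m ^ k) (n ^ k))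
  where open +-*-Solver

m≤m^[1+k] : ∀ m k → m ≤ m ^ suc k
m≤m^[1+k] zero      k = z≤n
m≤m^[1+k] m@(suc _) k = ≤-trans (≤-reflexive (sym (*-identityʳ m))) (*-monoʳ-≤ m (m^n>0 m k))

-- Split the exponential into `m` equal parts: with `a = l / m`, the bound
-- `l ≤ m * suc a ≤ m * 2 ^ a` is raised to the power `m`. For logarithmic `l`, powers of `l` thus
-- cost one linear factor.
polylog : ∀ m .{{_ : NonZero m}} l → l ^ m ≤ m ^ m * 2 ^ l
polylog m l = begin
  l ^ m                   ≤⟨ ^-monoˡ-≤ m l≤ ⟩
  (m * suc a) ^ m         ≡⟨ ^-distrib-* m m (suc a) ⟩
  m ^ m * suc a ^ m       ≤⟨ *-monoʳ-≤ (m ^ m) (^-monoˡ-≤ m (m<2^m a)) ⟩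
  m ^ m * (2 ^ a) ^ m     ≡⟨ cong (m ^ m *_) (^-*-assoc 2 a m) ⟩
  m ^ m * 2 ^ (a * m)     ≤⟨ *-monoʳ-≤ (m ^ m) (^-monoʳ-≤ 2 (m/n*n≤m l m)) ⟩
  m ^ m * 2 ^ l           ∎
  where
  open ≤-Reasoning
  a = l / m
  l≤ : l ≤ m * suc a
  l≤ = begin
    l                ≡⟨ m≡m%n+[m/n]*n l m ⟩
    l % m + a * m    ≤⟨ +-monoˡ-≤ (a * m) (<⇒≤ (m%n<n l m)) ⟩
    suc a * m        ≡⟨ *-comm (suc a) m ⟩
    m * suc a        ∎

-- `cellsUsed` agrees with the number of vertices up to constant factors. It is positive and a
-- product, which suits bounding it by powers of 2.
vertices cellsUsed : ℕ → ℕ → ℕ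
vertices n d = (3 + d) + 2 * (n * (2 + d))
cellsUsed n d = suc n * suc d

vertices≤ : ∀ n d → vertices n d ≤ 4 * cellsUsed n d
vertices≤ n d = subst (vertices n d ≤_) (eq n d) (m≤m+n (vertices n d) _)
  where
  open +-*-Solver
  eq : ∀ n d → (3 + d) + 2 * (n * (2 + d)) + (1 + 3 * d + 2 * (n * d)) ≡ 4 * (suc n * suc d)
  eq = solve 2 (λ n d → (con 3 :+ d) :+ con 2 :* (n :* (con 2 :+ d)) :+ (con 1 :+ con 3 :* d :+ con 2 :* (n :* d)) :=
    con 4 :* ((con 1 :+ n) :* (con 1 :+ d))) refl

cellsUsed≤vertices : ∀ n d → cellsUsed n d ≤ vertices n d
cellsUsed≤vertices n d = subst (cellsUsed n d ≤_) (eq n d) (m≤m+n (cellsUsed n d) _)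
  where
  open +-*-Solver
  eq : ∀ n d → suc n * suc d + (2 + 3 * n + n * d) ≡ (3 + d) + 2 * (n * (2 + d))
  eq = solve 2 (λ n d → (con 1 :+ n) :* (con 1 :+ d) :+ (con 2 :+ con 3 :* n :+ n :* d) :=
    (con 3 :+ d) :+ con 2 :* (n :* (con 2 :+ d))) refl

-- Used as a time bound and as a bound on words. `n + d + 4` covers the words present at the start
-- and the constants loaded; the other 2 pays for the guest's `halt` in the former and gives
-- strictness in the latter.
overhead : ℕ → ℕ → ℕ
overhead n d = buildTime n d + (readoutTime n d + (n + d + 6))

overhead≤ : ∀ n d → overhead n d ≤ 500 * cellsUsed n d
overhead≤ n d = subst (overhead n d ≤_) (eq n d) (m≤m+n (overhead n d) _)
  where
  open +-*-Solver
  eq : ∀ n d → overhead n d + (355 + 479 * d + 377 * n + 398 * (n * d)) ≡ 500 * (suc n * suc d)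
  eq = solve 2 (λ n d →
    (con 20 :+ ((n :* (con 7 :+ d :* con 8) :+ con 1) :+ (con 40 :+ (((con 1 :+ d) :* con 14 :+ con 1) :+
    (con 1 :+ ((con 3 :+ n :* (con 45 :+ d :* con 44)) :+ (con 1 :+ ((con 3 :+ n :* (con 45 :+ d :* con 44)) :+ con 20)))))))) :+
    ((con 20 :+ ((d :* con 6 :+ con 1) :+ (con 3 :+ ((n :* (con 25 :+ d :* con 6) :+ con 1) :+ con 10)))) :+ (n :+ d :+ con 6))
    :+ (con 355 :+ con 479 :* d :+ con 377 :* n :+ con 398 :* (n :* d))
    := con 500 :* ((con 1 :+ n) :* (con 1 :+ d))) refl

-- Guest words are polynomial in `u = cellsUsed n d`, and `u ≤ 2 ^ ((1 + p) * l)`. The factor 512 =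
-- 2^9 absorbs the constants and turns `1 + p` into `10 + p`; one extra power of `z` makes room for
-- the overhead.
space-bound : ∀ p k′ → ∃[ k ] (∀ n d → d ≤ p * (1 + ⌊log₂ n ⌋) →
              overhead n d + 2 ^ wordLength k′ (vertices n d) ≤ 2 ^ wordLength k n)
space-bound p k′ = (10 + p) * suc k′ , λ n d d≤ →
  let open ≤-Reasoning
      u = cellsUsed n d
      z = 512 * u
      v = vertices n d
      l = 1 + ⌊log₂ n ⌋
      1≤z^ : 1 ≤ z ^ k′
      1≤z^ = m^n>0 z k′
      word≤ : 2 ^ (k′ * (1 + ⌊log₂ v ⌋)) ≤ z ^ k′
      word≤ = begin
        2 ^ (k′ * (1 + ⌊log₂ v ⌋))   ≡⟨ cong (2 ^_) (*-comm k′ _) ⟩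
        2 ^ ((1 + ⌊log₂ v ⌋) * k′)   ≡⟨ ^-*-assoc 2 (1 + ⌊log₂ v ⌋) k′ ⟨
        (2 * 2 ^ ⌊log₂ v ⌋) ^ k′     ≤⟨ ^-monoˡ-≤ k′ (*-monoʳ-≤ 2 (log-lower v (s≤s z≤n))) ⟩
        (2 * v) ^ k′                 ≤⟨ ^-monoˡ-≤ k′ (*-monoʳ-≤ 2 (vertices≤ n d)) ⟩
        (2 * (4 * u)) ^ k′           ≡⟨ cong (_^ k′) (*-assoc 2 4 u) ⟨
        (8 * u) ^ k′                 ≤⟨ ^-monoˡ-≤ k′ (*-monoˡ-≤ u {8} {512} (≤ᵇ⇒≤ 8 512 tt)) ⟩
        z ^ k′                       ∎
      u≤ : u ≤ 2 ^ ((1 + p) * l)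
      u≤ = begin
        suc n * suc d         ≤⟨ *-mono-≤ (log-upper n) (s≤s d≤) ⟩
        2 ^ l * suc (p * l)   ≤⟨ *-monoʳ-≤ (2 ^ l) (m<2^m (p * l)) ⟩
        2 ^ l * 2 ^ (p * l)   ≡⟨ ^-distribˡ-+-* 2 l (p * l) ⟨
        2 ^ ((1 + p) * l)     ∎
      z≤ : z ≤ 2 ^ ((10 + p) * l)
      z≤ = begin
        2 ^ 9 * u                          ≤⟨ *-mono-≤ (^-monoʳ-≤ 2 (m≤m*n 9 l)) u≤ ⟩
        2 ^ (9 * l) * 2 ^ ((1 + p) * l)    ≡⟨ ^-distribˡ-+-* 2 (9 * l) ((1 + p) * l) ⟨
        2 ^ (9 * l + (1 + p) * l)          ≡⟨ cong (2 ^_) (*-distribʳ-+ l 9 (1 + p)) ⟨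
        2 ^ ((10 + p) * l)                 ∎
  in begin
  overhead n d + 2 ^ (k′ * (1 + ⌊log₂ v ⌋))   ≤⟨ +-mono-≤ (overhead≤ n d) word≤ ⟩
  500 * u + z ^ k′                            ≤⟨ +-mono-≤ (m≤m*n (500 * u) (z ^ k′) {{>-nonZero 1≤z^}}) (m≤n*m (z ^ k′) u) ⟩
  500 * u * z ^ k′ + u * z ^ k′               ≡⟨ *-distribʳ-+ (z ^ k′) (500 * u) u ⟨
  (500 * u + u) * z ^ k′                      ≡⟨ cong (_* z ^ k′) (+-comm (500 * u) u) ⟩
  (501 * u) * z ^ k′                          ≤⟨ *-monoˡ-≤ (z ^ k′) (*-monoˡ-≤ u {501} {512} (≤ᵇ⇒≤ 501 512 tt)) ⟩
  z ^ suc k′                                  ≤⟨ ^-monoˡ-≤ (suc k′) z≤ ⟩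
  (2 ^ ((10 + p) * l)) ^ suc k′               ≡⟨ ^-*-assoc 2 ((10 + p) * l) (suc k′) ⟩
  2 ^ ((10 + p) * l * suc k′)                 ≡⟨ cong (2 ^_) (solve 3 (λ a l k → a :* l :* k := a :* k :* l) refl (10 + p) l (suc k′)) ⟩
  2 ^ ((10 + p) * suc k′ * l)                 ∎
  where open +-*-Solver

-- The exponent of the running time

module _ (p q₀ p₀ C : ℕ) where

  private
    -- With saving 1/q, the q-th power of the time is of order `N ^ e`, where `e` is 2q - 1. The new
    -- saving 1/2q calls for its square, of order `N ^ m`, with `m` equal to 4q - 2.
    q e m E G K : ℕ
    q = suc q₀
    e = suc (q₀ + q₀)
    m = e + e
    E = 8 * suc p
    G = 502 * suc C
    K = E ^ m * m ^ m * 2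

  timeFactor : ℕ
  timeFactor = G * K

  open ≤-Reasoning
  open +-*-Solver using (solve; _:=_; _:+_; _:*_; con)

  -- t ≤ C · N^(2 − p/q) is used only in the weaker form t ≤ C · N^(2 − 1/q).
  weaken-exponent : ∀ N t .{{_ : NonZero N}} → t ^ q * N ^ suc p₀ ≤ (C * N ^ 2) ^ q → t ^ q ≤ C ^ q * N ^ e
  weaken-exponent N t h = *-cancelʳ-≤ (t ^ q) (C ^ q * N ^ e) N (begin
    t ^ q * N             ≤⟨ *-monoʳ-≤ (t ^ q) (m≤m^[1+k] N p₀) ⟩
    t ^ q * N ^ suc p₀    ≤⟨ h ⟩
    (C * N ^ 2) ^ q       ≡⟨ ^-distrib-* q C (N ^ 2) ⟩
    C ^ q * (N ^ 2) ^ q   ≡⟨ cong (C ^ q *_) (^-*-assoc N 2 q) ⟩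
    C ^ q * N ^ (2 * q)   ≡⟨ cong (λ x → C ^ q * N ^ x) (solve 1 (λ x → con 2 :* (con 1 :+ x) := con 1 :+ (con 1 :+ (x :+ x))) refl q₀) ⟩
    C ^ q * (N * N ^ e)   ≡⟨ solve 3 (λ a b c → a :* (b :* c) := a :* c :* b) refl (C ^ q) N (N ^ e) ⟩
    C ^ q * N ^ e * N     ∎)

  -- Passing to `N ⊔ t` avoids expanding the power of a sum. The linear overhead is harmless because
  -- `q ≤ e`, and `suc C` covers the case that `C` is 0.
  total-time : ∀ N t s .{{_ : NonZero N}} → t ^ q ≤ C ^ q * N ^ e → s ≤ 500 * N + t * 2 → s ^ q ≤ G ^ q * N ^ e
  total-time N t s h s≤ = begin
    s ^ q                       ≤⟨ ^-monoˡ-≤ q s≤502 ⟩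
    (502 * (N ⊔ t)) ^ q         ≡⟨ ^-distrib-* q 502 (N ⊔ t) ⟩
    502 ^ q * (N ⊔ t) ^ q       ≤⟨ *-monoʳ-≤ (502 ^ q) (⊔-lub-^ (≤-total N t)) ⟩
    502 ^ q * (suc C ^ q * N ^ e) ≡⟨ *-assoc (502 ^ q) _ _ ⟨
    502 ^ q * suc C ^ q * N ^ e ≡⟨ cong (_* N ^ e) (^-distrib-* q 502 (suc C)) ⟨
    G ^ q * N ^ e               ∎
    where
    s≤502 : s ≤ 502 * (N ⊔ t)
    s≤502 = begin
      s                                 ≤⟨ s≤ ⟩
      500 * N + t * 2                   ≤⟨ +-mono-≤ (*-monoʳ-≤ 500 (m≤m⊔n N t)) (*-monoˡ-≤ 2 (m≤n⊔m N t)) ⟩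
      500 * (N ⊔ t) + (N ⊔ t) * 2       ≡⟨ solve 1 (λ x → con 500 :* x :+ x :* con 2 := con 502 :* x) refl (N ⊔ t) ⟩
      502 * (N ⊔ t)                     ∎
    ⊔-lub-^ : N ≤ t ⊎ t ≤ N → (N ⊔ t) ^ q ≤ suc C ^ q * N ^ e
    ⊔-lub-^ (inj₁ N≤t) = begin
      (N ⊔ t) ^ q            ≡⟨ cong (_^ q) (m≤n⇒m⊔n≡n N≤t) ⟩
      t ^ q                  ≤⟨ h ⟩
      C ^ q * N ^ e          ≤⟨ *-monoˡ-≤ (N ^ e) (^-monoˡ-≤ q (n≤1+n C)) ⟩
      suc C ^ q * N ^ e      ∎
    ⊔-lub-^ (inj₂ t≤N) = begin
      (N ⊔ t) ^ q            ≡⟨ cong (_^ q) (m≥n⇒m⊔n≡m t≤N) ⟩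
      N ^ q                  ≤⟨ ^-monoʳ-≤ N (s≤s (m≤m+n q₀ q₀)) ⟩
      N ^ e                  ≤⟨ m≤n*m (N ^ e) (suc C ^ q) {{m^n≢0 (suc C) q}} ⟩
      suc C ^ q * N ^ e      ∎

  -- The logarithmic factors, even to the power `m`, are swallowed by a single extra factor `n`. The
  -- dimension constant enters only through `K`.
  vertices-polylog : ∀ n d → 1 ≤ n → d ≤ p * (1 + ⌊log₂ n ⌋) → vertices n d ^ m ≤ K * (n * n ^ m)
  vertices-polylog n d 1≤n d≤ = begin
    vertices n d ^ m                   ≤⟨ ^-monoˡ-≤ m linear ⟩
    (E * l * n) ^ m                    ≡⟨ ^-distrib-* m (E * l) n ⟩
    (E * l) ^ m * n ^ m                ≡⟨ cong (_* n ^ m) (^-distrib-* m E l) ⟩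
    E ^ m * l ^ m * n ^ m              ≤⟨ *-monoˡ-≤ (n ^ m) (*-monoʳ-≤ (E ^ m) (polylog m l)) ⟩
    E ^ m * (m ^ m * 2 ^ l) * n ^ m    ≤⟨ *-monoˡ-≤ (n ^ m) (*-monoʳ-≤ (E ^ m) (*-monoʳ-≤ (m ^ m) (*-monoʳ-≤ 2 (log-lower n 1≤n)))) ⟩
    E ^ m * (m ^ m * (2 * n)) * n ^ m  ≡⟨ solve 4 (λ a b n x → a :* (b :* (con 2 :* n)) :* x := a :* b :* con 2 :* (n :* x)) refl (E ^ m) (m ^ m) n (n ^ m) ⟩
    K * (n * n ^ m)                    ∎
    where
    l = 1 + ⌊log₂ n ⌋
    linear : vertices n d ≤ E * l * n
    linear = begin
      vertices n d              ≤⟨ vertices≤ n d ⟩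
      4 * (suc n * suc d)       ≤⟨ *-monoʳ-≤ 4 (*-mono-≤ (+-monoˡ-≤ n 1≤n) (+-mono-≤ (s≤s (z≤n {⌊log₂ n ⌋})) d≤)) ⟩
      4 * ((n + n) * (l + p * l)) ≡⟨ solve 3 (λ n l p → con 4 :* ((n :+ n) :* (l :+ p :* l)) := con 8 :* (con 1 :+ p) :* l :* n) refl n l p ⟩
      E * l * n                 ∎

  time-bound : ∀ n d t s → d ≤ p * (1 + ⌊log₂ n ⌋) →
    t ^ q * vertices n d ^ suc p₀ ≤ (C * vertices n d ^ 2) ^ q → s ≤ overhead n d + t * 2 →
    s ^ (q + q) * n ^ 1 ≤ (timeFactor * n ^ 2) ^ (q + q)
  -- For `n = 0` the left side vanishes through its factor `n ^ 1`.
  time-bound zero d t s d≤ h s≤ = ≤-trans (≤-reflexive (*-zeroʳ (s ^ (q + q)))) z≤n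
  time-bound n@(suc _) d t s d≤ h s≤ = begin
    s ^ (q + q) * n ^ 1                      ≡⟨ cong₂ _*_ (^-distribˡ-+-* s q q) (*-identityʳ n) ⟩
    s ^ q * s ^ q * n                        ≤⟨ *-monoˡ-≤ n (*-mono-≤ s^q≤ s^q≤) ⟩
    G ^ q * N ^ e * (G ^ q * N ^ e) * n      ≡⟨ solve 3 (λ a b n → a :* b :* (a :* b) :* n := a :* a :* (b :* b) :* n) refl (G ^ q) (N ^ e) n ⟩
    G ^ q * G ^ q * (N ^ e * N ^ e) * n      ≡⟨ cong₂ (λ x y → x * y * n) (^-distribˡ-+-* G q q) (^-distribˡ-+-* N e e) ⟨
    -- Here `m + 2` equals 4q: one factor `n` pays for the logarithms, the other is the saving that
    -- remains.
    G ^ (q + q) * N ^ m * n                  ≤⟨ *-monoˡ-≤ n (*-monoʳ-≤ (G ^ (q + q)) (vertices-polylog n d (s≤s z≤n) d≤)) ⟩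
    G ^ (q + q) * (K * (n * n ^ m)) * n      ≤⟨ *-monoˡ-≤ n (*-monoʳ-≤ (G ^ (q + q)) (*-monoˡ-≤ (n * n ^ m) (m≤m^[1+k] K (q₀ + q)))) ⟩
    G ^ (q + q) * (K ^ (q + q) * (n * n ^ m)) * n ≡⟨ solve 4 (λ a b n x → a :* (b :* (n :* x)) :* n := a :* b :* (n :* (n :* x))) refl (G ^ (q + q)) (K ^ (q + q)) n (n ^ m) ⟩
    G ^ (q + q) * K ^ (q + q) * n ^ (2 + m)  ≡⟨ cong₂ _*_ (sym (^-distrib-* (q + q) G K)) (cong (n ^_)
      (solve 1 (λ x → con 2 :+ ((con 1 :+ (x :+ x)) :+ (con 1 :+ (x :+ x))) := con 2 :* ((con 1 :+ x) :+ (con 1 :+ x))) refl q₀)) ⟩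
    (G * K) ^ (q + q) * n ^ (2 * (q + q))    ≡⟨ cong ((G * K) ^ (q + q) *_) (^-*-assoc n 2 (q + q)) ⟨
    (G * K) ^ (q + q) * (n ^ 2) ^ (q + q)    ≡⟨ ^-distrib-* (q + q) (G * K) (n ^ 2) ⟨
    (G * K * n ^ 2) ^ (q + q)                ∎
    where
    N = vertices n d
    s^q≤ : s ^ q ≤ G ^ q * N ^ e
    s^q≤ = total-time N t s (weaken-exponent N t h) (≤-trans s≤
      (+-monoˡ-≤ (t * 2) (≤-trans (overhead≤ n d) (*-monoʳ-≤ 500 (cellsUsed≤vertices n d)))))

-- The reduction

orthogonal-at : ∀ {d} (a b : Vec Bool d) → inner a b ≡ 0 → ∀ j → lookup a j ≡ true → lookup b j ≡ false
orthogonal-at (true ∷ a)  (false ∷ b) ortho zero    _ = refl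
orthogonal-at (x ∷ a)     (y ∷ b)     ortho (suc j) = orthogonal-at a b (m+n≡0⇒n≡0 (toBit x * toBit y) ortho) j

common-coordinate : ∀ {d} (a b : Vec Bool d) → inner a b ≢ 0 → ∃[ j ] lookup a j ≡ true × lookup b j ≡ true
common-coordinate [] [] meet = contradiction refl meet
common-coordinate (true ∷ a)  (true ∷ b)  meet = zero , refl , refl
common-coordinate (true ∷ a)  (false ∷ b) meet = let j , p = common-coordinate a b meet in suc j , p
common-coordinate (false ∷ a) (y ∷ b)     meet = let j , p = common-coordinate a b meet in suc j , p

ℕ⇒ℚ-mono-≤ : ∀ {m n} → m ≤ n → ℕ⇒ℚ m ℚ.≤ ℕ⇒ℚ n
ℕ⇒ℚ-mono-≤ {m} {n} m≤n = ℚₚ.toℚᵘ-cancel-≤ (ℚᵘₚ.≤-respˡ-≃ (ℚᵘₚ.≃-sym (ℚₚ.toℚᵘ-fromℚᵘ (ℚᵘ.mkℚᵘ (ℤ.+ m) 0)))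
  (ℚᵘₚ.≤-respʳ-≃ (ℚᵘₚ.≃-sym (ℚₚ.toℚᵘ-fromℚᵘ (ℚᵘ.mkℚᵘ (ℤ.+ n) 0)))
    (ℚᵘ.*≤* (ℤₚ.*-monoʳ-≤-nonNeg (ℤ.+ 1) (ℤ.+≤+ m≤n)))))

-- The only use of `δ`: it makes the product with 3 strictly smaller than 5, and integrality does
-- the rest.
below-5 : ∀ δ m → 0ℚ ℚ.< δ → ℕ⇒ℚ m ℚ.≤ ((ℤ.+ 5) ℚ./ 3 ℚ.- δ) ℚ.* ℕ⇒ℚ 3 → m ≤ 4
below-5 δ m 0<δ m≤ = ≤-pred (≰⇒> λ 5≤m → ℚₚ.<-irrefl refl
  (ℚₚ.≤-<-trans (ℚₚ.≤-trans (ℕ⇒ℚ-mono-≤ 5≤m) m≤)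
    (ℚₚ.*-monoˡ-<-pos (ℕ⇒ℚ 3) {(ℤ.+ 5) ℚ./ 3 ℚ.- δ} {(ℤ.+ 5) ℚ./ 3} (ℚₚ.+-monoʳ-< ((ℤ.+ 5) ℚ./ 3) (ℚₚ.neg-antimono-< 0<δ)))))

cell-≤ : ∀ {xs B} → All (_≤ B) xs → ∀ i → cell xs i ≤ B
cell-≤ []       i       = ≤-trans (≤-reflexive (cell-[] i)) z≤n
cell-≤ (p ∷ ps) zero    = p
cell-≤ (p ∷ ps) (suc i) = cell-≤ ps i

encodeVectors-≤1 : ∀ {k d} (as : Vec (Vec Bool d) k) → All (_≤ 1) (encodeVectors as)
encodeVectors-≤1 []       = []
encodeVectors-≤1 (a ∷ as) = Allₚ.++⁺ (bits≤1 a) (encodeVectors-≤1 as)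
  where
  bits≤1 : ∀ {d} (a : Vec Bool d) → All (_≤ 1) (bits a)
  bits≤1 []          = []
  bits≤1 (true ∷ a)  = ≤-refl ∷ bits≤1 a
  bits≤1 (false ∷ a) = z≤n ∷ bits≤1 a

encodeOV-≤ : ∀ {n d} (A B : Vec (Vec Bool d) n) → All (_≤ n + d + 4) (encodeOV A B)
encodeOV-≤ {n} {d} A B =
  ≤-trans (m≤m+n n d) (m≤m+n (n + d) 4) ∷ ≤-trans (m≤n+m d n) (m≤m+n (n + d) 4) ∷
  All.map (λ x≤1 → ≤-trans x≤1 (≤-trans (s≤s z≤n) (m≤n+m 4 (n + d))))
    (Allₚ.++⁺ (encodeVectors-≤1 A) (encodeVectors-≤1 B))

module Reduction (P : Program) where

  -- Both labels can be fixed in advance, since code lengths do not depend on the labels compiled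
  -- into the code.
  L exit : Label
  L    = codeSize build
  exit = L + length P * 2

  open Guest L exit

  reduction : Program
  reduction = compile 0 build ++ translate P ++ compile exit readout ++ halt ∷ []

  whole : CodeAt reduction 0 reduction
  whole = codeAt λ j i eq → eq

  afterBuild : CodeAt reduction L (translate P ++ compile exit readout ++ halt ∷ [])
  afterBuild = subst (λ l → CodeAt reduction l (translate P ++ compile exit readout ++ halt ∷ []))
    (length-compile 0 build) (CodeAt-right {is = compile 0 build} whole)

  afterGuest : CodeAt reduction exit (compile exit readout ++ halt ∷ [])
  afterGuest = subst (λ l → CodeAt reduction (L + l) (compile exit readout ++ halt ∷ []))
    (length-translate P) (CodeAt-right {l = L} {is = translate P} afterBuild)

  halts : reduction ‼ (exit + codeSize readout) ≡ just halt
  halts = CodeAt-head (subst (λ l → CodeAt reduction (exit + l) (halt ∷ []))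
    (length-compile exit readout) (CodeAt-right {l = exit} {is = compile exit readout} afterGuest))

  module _ {n d : ℕ} (A B : Vec (Vec Bool d) n) (w′ w : ℕ)
           (fits : overhead n d + 2 ^ w′ ≤ 2 ^ w) where

    open OVGraph A B
    open Encoding A B
    open Building n d (guestBase A B) (encodeOV A B) (≤-reflexive (length-encodeOV A B)) using (Built)

    -- `m₀`, `m₁` and `m₂` bound all words at the start, after the graph is written and after the
    -- guest has run.
    b m₀ m₁ m₂ : ℕ
    b  = guestBase A B
    m₀ = n + d + 4
    m₁ = buildTime n d + m₀
    m₂ = 2 ^ w′ + m₁

    room : readoutTime n d + m₂ < 2 ^ w
    room = <-≤-trans (subst (readoutTime n d + m₂ <_)
      (solve 5 (λ r x u n d → con 2 :+ (r :+ (x :+ (u :+ (n :+ d :+ con 4)))) := u :+ (r :+ (n :+ d :+ con 6)) :+ x) refl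
        (readoutTime n d) (2 ^ w′) (buildTime n d) n d)
      (m<n⇒m<1+n (n<1+n _))) fits
      where open +-*-Solver

    m₂< : m₂ < 2 ^ w
    m₂< = ≤-<-trans (m≤n+m m₂ (readoutTime n d)) room

    m₁< : m₁ < 2 ^ w
    m₁< = ≤-<-trans (m≤n+m m₁ (2 ^ w′)) m₂<

    module Host  = Machine w reduction
    module Inner = Machine w′ P
    open Running w reduction

    built : ∀ ρ μ → (∀ r → ρ r ≡ 0) → (∀ a → μ a ≡ cell (encodeOV A B) a) →
      ∃[ t ] ∃[ σ ] (at 0 (ρ , μ) Host.⟶[ t ] at L σ) × t ≤ buildTime n d ×
        Built (encodeGraph graph) σ × Bounded m₁ σ
    built ρ μ ρ≡0 μ≡ =
      let T₁ = build-correct A B (size graph) (ρ , μ) length-graphCells ρ≡0 μ≡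
          cost≤ = Triple.cost≤ T₁
          run , bd = compile-correct build {0} {ρ , μ} {m₀} tt (CodeAt-left whole) (m≤n+m 4 (n + d))
            ((λ r → ≤-trans (≤-reflexive (ρ≡0 r)) z≤n) ,
             (λ a → ≤-trans (≤-reflexive (μ≡ a)) (cell-≤ (encodeOV-≤ A B) a)))
            (≤-<-trans (+-monoˡ-≤ m₀ cost≤) m₁<)
      in _ , exec build (ρ , μ) , run , cost≤ , subst (λ xs → Built xs (exec build (ρ , μ))) (sym encodeGraph≡) (Triple.post T₁) ,
         Bounded-mono (+-monoˡ-≤ m₀ cost≤) bd

    guestStart : Config
    guestStart = ⟨ 0 , (λ _ → 0) , cell (encodeGraph graph) ⟩

    simulated : ∀ {σ t s} → Built (encodeGraph graph) σ → Bounded m₁ σ →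
      guestStart Inner.⟶[ t ] s → Inner.Halted s →
      ∃[ σ′ ] (at L σ Host.⟶[ t * 2 + 2 ] at exit σ′) ×
        (proj₁ σ′ 0 ≡ n × proj₁ σ′ 1 ≡ d × proj₁ σ′ 2 ≡ b × (∀ a → proj₂ σ′ (b + a) ≡ mem s a)) × Bounded m₂ σ′
    simulated {σ} {t} built bd run halted =
      let σ′ , run′ , S = simulateHalting run halted (simulates guest output (λ _ → m^n>0 2 w′) reg0 reg1 reg2
            (Bounded-mono (m≤n+m m₁ (2 ^ w′)) bd))
      in σ′ , subst (λ l → at l σ Host.⟶[ t * 2 + 2 ] at exit σ′) (+-identityʳ L) run′ ,
         (Simulates.reg0 S , Simulates.reg1 S , Simulates.reg2 S , Simulates.memory S) , Simulates.bounded S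
      where
      open Built built
      b≤m₁ : b ≤ m₁
      -- Register 2 contains `b`, so the bound on registers applies to it.
      b≤m₁ = subst (_≤ m₁) reg2 (proj₁ bd 2)
      open Simulation w′ w P reduction (CodeAt-left afterBuild) n d b m₂
        (+-monoʳ-≤ (2 ^ w′) b≤m₁) m₂<

    cell-A : ∀ i → b + number (vec zero i) ≡ toℕ i * (2 + d) + (d + (3 + b))
    cell-A i = trans (cong (b +_) (number-A i))
      (solve 3 (λ b d x → b :+ (x :+ (con 3 :+ d)) := x :+ (d :+ (con 3 :+ b))) refl b d (toℕ i * (2 + d)))
      where open +-*-Solver

    -- An orthogonal pair pushes one estimate up to 5 by the lower bound of the approximation;
    -- without a pair, the upper bound keeps the estimates of all vectors of A at 4 or below.
    decides : ∀ δ (μ′ μ : Addr → ℕ) → 0ℚ ℚ.< δ →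
      ApproximatesEccentricities ((ℤ.+ 5) ℚ./ 3 ℚ.- δ) graph μ → (∀ a → μ′ (b + a) ≡ μ a) →
      ∀ {x} → x ≡ 1 ∸ drain n (λ i → μ′ (i * (2 + d) + (d + (3 + b)))) 1 →
      (HasOrthogonalPair A B × x ≡ 1) ⊎ (¬ HasOrthogonalPair A B × x ≡ 0)
    decides δ μ′ μ 0<δ approx μ′≡ x≡ with Finₚ.any? (λ i → Finₚ.any? (λ j → inner (lookup A i) (lookup B j) ≟ 0))
    ... | yes pair@(i , k , ortho) = inj₁ (pair , trans x≡ (cong (1 ∸_) (drain-large n _ 1 i ≤-refl
      (subst (5 ≤_) (trans (sym (μ′≡ _)) (cong μ′ (cell-A i))) (proj₁ (approx (index (vec zero i)) 5
        (eccentricity-5 i k (orthogonal-at (lookup A i) (lookup B k) ortho))))))))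
    ... | no ¬pair = inj₂ (¬pair , trans x≡ (cong (1 ∸_) (drain-small n _ 1 λ i →
      subst (_≤ 4) (trans (sym (μ′≡ _)) (cong μ′ (cell-A i))) (below-5 δ _ 0<δ (proj₂ (approx (index (vec zero i)) 3
        (eccentricity-3 i λ k → common-coordinate (lookup A i) (lookup B k) λ ortho → ¬pair (i , k , ortho))))))))

    reduction-correct : ∀ δ {T : ℕ → Set} → 0ℚ ℚ.< δ →
      Computes w′ P (encodeGraph graph) T (ApproximatesEccentricities ((ℤ.+ 5) ℚ./ 3 ℚ.- δ) graph) →
      Computes w reduction (encodeOV A B) (λ s → ∃[ t ] T t × s ≤ overhead n d + t * 2) (DecidesOV A B)
    reduction-correct δ 0<δ computes ⟨ .0 , ρ , μ ⟩ (refl , ρ≡0 , μ≡) =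
      let t₁ , σ₁ , run₁ , t₁≤ , built₁ , bd₁ = built ρ μ ρ≡0 μ≡
          t , s , run , halted , Tt , approx = computes guestStart (refl , (λ _ → refl) , λ _ → refl)
          σ₂ , run₂ , (r0 , r1 , r2 , mem≡) , bd₂ = simulated built₁ bd₁ run halted
          T₃ = Reading.readout-correct n d (proj₂ σ₂) σ₂ r0 r1 r2 (λ _ → refl)
          t₃≤ = Triple.cost≤ T₃
          run₃ , _ = compile-correct readout {exit} {σ₂} {m₂} tt (CodeAt-left afterGuest)
            (≤-trans (m≤n+m 4 (n + d)) (≤-trans (m≤n+m m₀ (buildTime n d)) (m≤n+m m₁ (2 ^ w′))))
            bd₂ (≤-<-trans (+-monoˡ-≤ m₂ t₃≤) room)
      in _ , _ , run₁ ⟫ (run₂ ⟫ run₃) , halts ,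
         (t , Tt , total t₁≤ t₃≤ t) , decides δ (proj₂ σ₂) (mem s) 0<δ approx mem≡ (Triple.post T₃)
      where
      total : ∀ {t₁ t₃ u r} → t₁ ≤ u → t₃ ≤ r → ∀ t → t₁ + ((t * 2 + 2) + t₃) ≤ u + (r + (n + d + 6)) + t * 2
      total {u = u} {r} t₁≤ t₃≤ t = ≤-trans (+-mono-≤ t₁≤ (+-monoʳ-≤ (t * 2 + 2) t₃≤))
        (subst (u + ((t * 2 + 2) + r) ≤_)
          (solve 5 (λ u r t n d → u :+ ((t :* con 2 :+ con 2) :+ r) :+ (n :+ d :+ con 4) := u :+ (r :+ (n :+ d :+ con 6)) :+ t :* con 2)
            refl u r t n d)
          (m≤m+n _ (n + d + 4)))
        where open +-*-Solver

theorem1p2 : (∃[ δ ] 0ℚ ℚ.< δ × SubquadraticSparseEccentricities ((ℤ.+ 5) ℚ./ 3 ℚ.- δ)) →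
    ¬ OVConjecture
-- The constant 2 fits every instance, so program and exponent are fixed before `c` is given.
theorem1p2 (δ , 0<δ , algorithm) conjecture with algorithm 2
... | mkℚ (ℤ.+ 0)    q₀ _ , ℚ.*<* (ℤ.+<+ ()) , _
... | mkℚ -[1+ _ ] q₀ _ , ℚ.*<* () , _
... | mkℚ +[1+ p₀ ] q₀ _ , _ , P , k′ , C , correct = conjecture (ε , ℚ.*<* (ℤ.+<+ z<s) , decide)
  where
  ε : ℚ
  -- This is 1/2q: `mkℚ` stores the denominator minus 1, and q is `suc q₀`.
  ε = mkℚ (ℤ.+ 1) (q₀ + suc q₀) (1-coprimeTo _)
  decide : ∀ c → 1ℚ ℚ.≤ c → SubquadraticOV ε c
  decide c _ = Reduction.reduction P , k , timeFactor p q₀ p₀ C , λ n A B s init →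
    let d = ⌊ c ·log₂ n ⌋
        d≤ = dimension-bound c n
        t , s′ , run , halted , (t′ , T , t≤) , decided =
          Reduction.reduction-correct P A B (wordLength k′ (vertices n d)) (wordLength k n) (fits n d d≤) δ 0<δ
            (correct (OVGraph.graph A B) (OVGraph.connected A B) (Encoding.sparse A B)) s init
    in t , s′ , run , halted , time-bound p q₀ p₀ C n d t′ t d≤ T t≤ , decided
    where
    p = ∣ ↥ c ∣
    k = proj₁ (space-bound p k′)
    fits = proj₂ (space-bound p k′)
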